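{- Let $M$ be a metric space with metric $d$, let $s\in M$ and let $r>1$. For $n\in\mathbb{Z}$ let $M_n=\{s\}\cup\{p\in M : d(s,p)\in[r^n,r^{n+1})\}$ (with the restricted metric). If for each $n\in\mathbb{Z}$ the infinite server problem on $(M_n,s)$ admits a strictly $\rho$-competitive online algorithm, then the infinite server problem on $(M,s)$ admits a strictly $\frac{4r-1}{r-1}\rho$-competitive online algorithm.
   Context: Infinite server problem on $(M,s)$: $M$ is a metric space and $s\in M$ the source; an unbounded number of servers initially reside at $s$. A finite sequence of requests (points of $M$) is revealed one by one; each must be served immediately, without knowledge of future requests, by moving some server to it; the cost is the total distance traveled. An online algorithm $ALG$ is strictly $\rho$-competitive if $ALG(\sigma)\le\rho\,OPT(\sigma)$ for every request sequence $\sigma$, where $OPT(\sigma)$ is the optimal offline cost. -}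

module Defs where

open import Algebra.Bundles using (CommutativeRing; Semiring)
open import Algebra.Structures using (IsCommutativeRing)
import Algebra.Definitions.RawSemiring as RawSemiringDefinitions
open import Data.Bool.Base using (if_then_else_)
open import Data.Integer.Base as ℤ using (ℤ; +_; -[1+_])
open import Data.List.Base using (List; []; _∷_; length)
open import Data.List.Relation.Binary.Pointwise using (Pointwise)
open import Data.Nat.Base using (ℕ; suc)
import Data.Nat.Properties as ℕ
open import Data.Product.Base using (Σ; ∃; _×_; _,_; proj₁; proj₂)
open import Data.Sum.Base using (_⊎_; inj₁; inj₂)
open import Data.Vec.Base using (Vec; []; _∷_; replicate)
open import Function.Metric.Structures using (IsGeneralMetric)
open import Level using (_⊔_) renaming (suc to lsuc)
open import Relation.Binary.Core using (Rel)
import Relation.Binary.Construct.StrictToNonStrict as StrictToNonStrict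
open import Relation.Binary.PropositionalEquality.Core using (_≡_)
open import Relation.Binary.Structures using (IsStrictTotalOrder)
open import Relation.Nullary.Decidable.Core using (does)
open import Relation.Nullary.Negation.Core using (¬_)
open import Relation.Unary using (Pred)

-- The standard library has no real numbers, so they enter axiomatically, as
-- an arbitrary Dedekind-complete Archimedean ordered field; classically, this
-- is ℝ up to unique isomorphism. The order is trichotomous, hence decidable, as
-- in the classical theory.

record RealNumbers ℓ : Set (lsuc ℓ) where
  infix  4 _≈_ _<_
  infixl 6 _+_
  infixl 7 _*_
  infix  8 -_
  infix  9 _⁻¹
  infixr 8 _^ᶻ_
  field
    Carrier            : Set ℓ
    _≈_                : Rel Carrier ℓ
    _<_                : Rel Carrier ℓ
    _+_ _*_            : Carrier → Carrier → Carrier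
    -_                 : Carrier → Carrier
    0# 1#              : Carrier
    _⁻¹                : Carrier → Carrier
    isCommutativeRing  : IsCommutativeRing _≈_ _+_ _*_ -_ 0# 1#
    isStrictTotalOrder : IsStrictTotalOrder _≈_ _<_

  open StrictToNonStrict _≈_ _<_ public using (_≤_)

  UpperBound : Pred Carrier ℓ → Pred Carrier ℓ
  UpperBound P u = ∀ x → P x → x ≤ u

  Supremum : Pred Carrier ℓ → Pred Carrier ℓ
  Supremum P u = UpperBound P u × (∀ v → UpperBound P v → u ≤ v)

  commutativeRing : CommutativeRing ℓ ℓ
  commutativeRing = record { isCommutativeRing = isCommutativeRing }

  open CommutativeRing commutativeRing public using (_-_)
  open RawSemiringDefinitions (Semiring.rawSemiring (CommutativeRing.semiring commutativeRing)) public
    using (_^_) renaming (_×_ to _·_)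

  field
    0<1       : 0# < 1#
    +-monoʳ-< : ∀ x {y z} → y < z → x + y < x + z
    *-pos     : ∀ {x y} → 0# < x → 0# < y → 0# < x * y
    -- Nothing is assumed about the value of 0# ⁻¹.
    ⁻¹-cong   : ∀ {x y} → x ≈ y → x ⁻¹ ≈ y ⁻¹
    *-inverse : ∀ {x} → ¬ x ≈ 0# → x * x ⁻¹ ≈ 1#
    supremum  : ∀ P → ∃ P → ∃ (UpperBound P) → ∃ (Supremum P)
    -- This follows from `supremum` only with classical logic.
    archimedean : ∀ x → ∃ λ n → x < n · 1#

  _^ᶻ_ : Carrier → ℤ → Carrier
  x ^ᶻ (+ n)    = x ^ n
  x ^ᶻ -[1+ n ] = (x ⁻¹) ^ suc n

  LowerBound : Pred Carrier ℓ → Pred Carrier ℓ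
  LowerBound P l = ∀ x → P x → l ≤ x

  Infimum : Pred Carrier ℓ → Pred Carrier ℓ
  Infimum P l = LowerBound P l × (∀ v → LowerBound P v → v ≤ l)

  infimum : ∀ P → ∃ P → ∃ (LowerBound P) → ∃ (Infimum P)
  infimum P (x , Px) lower
    with supremum (LowerBound P) lower (x , λ _ l≤ → l≤ x Px)
  ... | i , above , least =
    i , (λ y Py → least y (λ _ l≤ → l≤ y Py)) , above

  private
    open module R = CommutativeRing commutativeRing using (+-identityʳ; +-identityˡ; +-congˡ; +-congʳ)
    open module O = IsStrictTotalOrder isStrictTotalOrder using (<-respˡ-≈; <-respʳ-≈)

  +-nonneg : ∀ {x y} → 0# ≤ x → 0# ≤ y → 0# ≤ x + y
  +-nonneg {x} {y} (inj₁ 0<x) (inj₁ 0<y) =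
    inj₁ (O.trans 0<x (<-respˡ-≈ (+-identityʳ x) (+-monoʳ-< x 0<y)))
  +-nonneg {x} {y} (inj₂ 0≈x) 0≤y =
    respʳ 0≤y (R.trans (R.sym (+-identityˡ y)) (+-congʳ 0≈x))
    where
    respʳ : ∀ {y z} → 0# ≤ y → y ≈ z → 0# ≤ z
    respʳ (inj₁ 0<y) y≈z = inj₁ (<-respʳ-≈ y≈z 0<y)
    respʳ (inj₂ 0≈y) y≈z = inj₂ (R.trans 0≈y y≈z)
  +-nonneg {x} {y} (inj₁ 0<x) (inj₂ 0≈y) =
    inj₁ (<-respʳ-≈ (R.trans (R.sym (+-identityʳ x)) (+-congˡ 0≈y)) 0<x)

module _ {ℓ} (ℝ : RealNumbers ℓ) where

  private module ℝ = RealNumbers ℝ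
  open ℝ using (_≤_; _<_; _^ᶻ_) renaming (Carrier to R)

  -- Points form a setoid; its equality is the relation d p q ≈ 0#.
  record MetricSpace a e : Set (ℓ ⊔ lsuc (a ⊔ e)) where
    infix 4 _≈_
    field
      Point    : Set a
      _≈_      : Rel Point e
      d        : Point → Point → R
      isMetric : IsGeneralMetric _≈_ ℝ._≈_ _≤_ ℝ.0# ℝ._+_ d

    open IsGeneralMetric isMetric public
      using (isPartialOrder; ≈-isEquivalence; cong; nonNegative; ≈⇒0; 0⇒≈; sym; triangle; module EqC)

  subspace : ∀ {a e p} (M : MetricSpace a e) → Pred (MetricSpace.Point M) p →
             MetricSpace (a ⊔ p) e
  subspace M P = record
    { Point    = Σ M.Point P
    ; _≈_      = λ x y → proj₁ x M.≈ proj₁ y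
    ; d        = λ x y → M.d (proj₁ x) (proj₁ y)
    ; isMetric = record
      { isSemiMetric = record
        { isQuasiSemiMetric = record
          { isPreMetric = record
            { isProtoMetric = record
              { isPartialOrder  = M.isPartialOrder
              ; ≈-isEquivalence = record
                { refl  = M.EqC.refl
                ; sym   = M.EqC.sym
                ; trans = M.EqC.trans
                }
              ; cong            = M.cong
              ; nonNegative     = M.nonNegative
              }
            ; ≈⇒0 = M.≈⇒0
            }
          ; 0⇒≈ = M.0⇒≈
          }
        ; sym = λ x y → M.sym (proj₁ x) (proj₁ y)
        }
      ; triangle = λ x y z → M.triangle (proj₁ x) (proj₁ y) (proj₁ z)
      }
    }
    where module M = MetricSpace M

  module Annulus {a e} (M : MetricSpace a e) (s : MetricSpace.Point M) (r : R) (n : ℤ) where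
    open MetricSpace M

    InAnnulus : Pred Point (e ⊔ ℓ)
    InAnnulus p = p ≈ s ⊎ (r ^ᶻ n ≤ d s p × d s p < r ^ᶻ ℤ.suc n)

    annulus : MetricSpace (a ⊔ e ⊔ ℓ) e
    annulus = subspace M InAnnulus

    source : MetricSpace.Point annulus
    source = s , inj₁ EqC.refl

  open Annulus public using (annulus; source)

  module InfiniteServer {a e} (M : MetricSpace a e) (s : MetricSpace.Point M) where
    open MetricSpace M

    Configuration : Set a
    Configuration = ℕ → Point

    initial : Configuration
    initial _ = s

    move : ℕ → Point → Configuration → Configuration
    move i p C j = if does (j ℕ.≟ i) then p else C j

    -- A schedule for σ names, for each request in turn, the server moved to it.
    Schedule : List Point → Set
    Schedule σ = Vec ℕ (length σ)

    costFrom : Configuration → (σ : List Point) → Schedule σ → R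
    costFrom C []      []       = ℝ.0#
    costFrom C (p ∷ σ) (i ∷ is) = d (C i) p ℝ.+ costFrom (move i p C) σ is

    cost : (σ : List Point) → Schedule σ → R
    cost = costFrom initial

    costFrom-nonneg : ∀ C σ is → ℝ.0# ≤ costFrom C σ is
    costFrom-nonneg C []      []       = inj₂ (CommutativeRing.refl ℝ.commutativeRing)
    costFrom-nonneg C (p ∷ σ) (i ∷ is) =
      ℝ.+-nonneg nonNegative (costFrom-nonneg (move i p C) σ is)

    Attainable : List Point → Pred R ℓ
    Attainable σ x = ∃ λ is → x ℝ.≈ cost σ is

    private
      optimum : ∀ σ → ∃ (ℝ.Infimum (Attainable σ))
      optimum σ = ℝ.infimum (Attainable σ)
        (cost σ is₀ , is₀ , CommutativeRing.refl ℝ.commutativeRing)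
        (ℝ.0# , λ { x (is , x≈) → ≤-respʳ-≈ (EqR.sym x≈) (costFrom-nonneg initial σ is) })
        where
        is₀ : Schedule σ
        is₀ = replicate (length σ) 0
        module EqR = CommutativeRing ℝ.commutativeRing
        open IsGeneralMetric isMetric using (≤-respʳ-≈)

    OPT : List Point → R
    OPT σ = proj₁ (optimum σ)

    OPT-infimum : ∀ σ → ℝ.Infimum (Attainable σ) (OPT σ)
    OPT-infimum σ = proj₂ (optimum σ)

    -- `respond past p` is the server moved to the current request p, where
    -- `past` lists the earlier requests, most recent first. The algorithm's
    -- own earlier choices are determined by `past`.
    record OnlineAlgorithm : Set (a ⊔ e) where
      field
        respond : List Point → Point → ℕ
        respects-≈ : ∀ {past past′ p p′} → Pointwise _≈_ past past′ → p ≈ p′ →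
                     respond past p ≡ respond past′ p′

      scheduleAfter : List Point → (σ : List Point) → Schedule σ
      scheduleAfter past []      = []
      scheduleAfter past (p ∷ σ) = respond past p ∷ scheduleAfter (p ∷ past) σ

      ALG : List Point → R
      ALG σ = cost σ (scheduleAfter [] σ)

    StrictlyCompetitive : R → OnlineAlgorithm → Set (a ⊔ ℓ)
    StrictlyCompetitive ρ A = ∀ σ → OnlineAlgorithm.ALG A σ ≤ ρ ℝ.* OPT σ

    AdmitsStrictlyCompetitive : R → Set (a ⊔ e ⊔ ℓ)
    AdmitsStrictlyCompetitive ρ = ∃ λ A → StrictlyCompetitive ρ A

  open InfiniteServer public using (AdmitsStrictlyCompetitive)

{-# OPTIONS --safe #-}

-- The combined algorithm runs the given algorithms side by side, each with its own pool of servers.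
-- Conversely, fix a schedule for M and an annulus M_n, let K = r / (r - 1), and replay the part of
-- the schedule inside M_n with a copy of every server. A request at p is served by the copy c of
-- the scheduled server or by a new server from s, whichever is cheaper. For a server at x this
-- is paid for by the potential
--   max (0, min (d(c,x), K (d(s,x) - r^(n-1)), K (r^(n+2) - d(s,x)))),
-- which is K-Lipschitz in x and at least min (d(c,x), d(s,x)) on M_n, and vanishes unless x lies in
-- M_(n-1), M_n or M_(n+1). Hence only the moves of the schedule that end in these three annuli have
-- to be charged, at rate K, and summing over n the total is at most 3K = 3r / (r - 1) times the
-- cost of the schedule, which is even less than (4r - 1) / (r - 1) = 3K + 1 times.

module Submission where

open import Defs
open import Algebra.Bundles using (CommutativeRing)
import Algebra.Construct.NaturalChoice.Max as Max
import Algebra.Construct.NaturalChoice.MaxOp as MaxOp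
import Algebra.Construct.NaturalChoice.Min as Min
import Algebra.Construct.NaturalChoice.MinOp as MinOp
import Algebra.Properties.Ring as RingProperties
import Algebra.Solver.Ring.NaturalCoefficients.Default as Solver
open import Data.Bool.Base using (if_then_else_)
open import Data.Integer.Base as ℤ using (ℤ; +_; -[1+_])
import Data.Integer.Properties as ℤ
open import Data.List.Base using (List; []; _∷_; deduplicate)
open import Data.List.Membership.Propositional using (_∈_)
open import Data.List.Membership.Propositional.Properties using (∈-deduplicate⁺)
open import Data.List.Relation.Binary.Pointwise as Pointwise using (Pointwise; []; _∷_)
open import Data.List.Relation.Unary.All as All using (All; []; _∷_)
open import Data.List.Relation.Unary.AllPairs using ([]; _∷_)
open import Data.List.Relation.Unary.Any using (here; there)
open import Data.List.Relation.Unary.Unique.DecPropositional.Properties using (deduplicate-!)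
open import Data.List.Relation.Unary.Unique.Propositional using (Unique)
open import Data.Nat.Base as ℕ using (ℕ; zero; suc)
import Data.Nat.Properties as ℕ
open import Data.Product.Base using (∃; _×_; _,_; proj₁; proj₂)
open import Data.Sum.Base using (_⊎_; inj₁; inj₂)
open import Data.Vec.Base using ([]; _∷_; toList)
open import Function.Base using (_∘_; id)
open import Relation.Binary.Bundles using (StrictTotalOrder; DecTotalOrder)
open import Relation.Binary.Definitions using (tri<; tri≈; tri>)
import Relation.Binary.Properties.StrictTotalOrder as StrictTotalOrderProperties
open import Relation.Binary.PropositionalEquality as ≡ using (_≡_; _≢_; refl)
import Relation.Binary.Reasoning.StrictPartialOrder as StrictReasoning
open import Relation.Nullary.Decidable using (dec-true; dec-false)
open import Relation.Nullary.Decidable.Core using (Dec; yes; no; does; _×-dec_)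
open import Relation.Nullary.Negation.Core using (¬_; contradiction)

-- Arithmetic of the ordered field.

module RealProperties {ℓ} (ℝ : RealNumbers ℓ) where
  open RealNumbers ℝ
  private module R = CommutativeRing commutativeRing
  open R public using (+-cong; +-congˡ; +-congʳ; +-comm; +-assoc; +-identityˡ; +-identityʳ;
    *-cong; *-congˡ; *-congʳ; *-comm; *-assoc; *-identityˡ; *-identityʳ; distribˡ; distribʳ; zeroˡ; zeroʳ)
  open RingProperties R.ring using (-‿distribʳ-*; -‿distribˡ-*; -‿involutive)
  open Solver R.commutativeSemiring public using (Polynomial; solve; _:=_; _:+_; _:*_; con)

  strictTotalOrder : StrictTotalOrder ℓ ℓ ℓ
  strictTotalOrder = record { isStrictTotalOrder = isStrictTotalOrder }

  open StrictTotalOrder strictTotalOrder public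
    using (compare; irrefl; <-respˡ-≈; <-respʳ-≈; strictPartialOrder)
    renaming (trans to <-trans; _<?_ to infix 4 _<?_; module Eq to ≈)
  open StrictTotalOrderProperties strictTotalOrder public
    using (decTotalOrder)
  open DecTotalOrder decTotalOrder public
    using (total; totalOrder; ≤-respʳ-≈)
    renaming (refl to ≤-refl; trans to ≤-trans; reflexive to ≤-reflexive; _≤?_ to infix 4 _≤?_)
  open StrictReasoning strictPartialOrder public

  open Min totalOrder public using (_⊓_)
  open Max totalOrder public using (_⊔_)
  open MinOp (Min.minOperator totalOrder) public using (x⊓y≤x; x⊓y≤y; ⊓-sel; ⊓-glb)
  open MaxOp (Max.maxOperator totalOrder) public using (x≤x⊔y; ⊔-lub) renaming (x≤y⊔x to y≤x⊔y)

  infix 4 _≟_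
  _≟_ : ∀ x y → Dec (x ≈ y)
  _≟_ = ≈._≟_

  <⇒≤ : ∀ {x y} → x < y → x ≤ y
  <⇒≤ = inj₁

  <⇒≱ : ∀ {x y} → x < y → ¬ y ≤ x
  <⇒≱ x<y y≤x = irrefl ≈.refl (begin-strict _ <⟨ x<y ⟩ _ ≤⟨ y≤x ⟩ _ ∎)

  ≮⇒≥ : ∀ {x y} → ¬ x < y → y ≤ x
  ≮⇒≥ {x} {y} x≮y with compare x y
  ... | tri< x<y _ _ = contradiction x<y x≮y
  ... | tri≈ _ x≈y _ = ≤-reflexive (≈.sym x≈y)
  ... | tri> _ _ y<x = inj₁ y<x

  +-monoʳ-≤ : ∀ x {y z} → y ≤ z → x + y ≤ x + z
  +-monoʳ-≤ x (inj₁ y<z) = inj₁ (+-monoʳ-< x y<z)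
  +-monoʳ-≤ x (inj₂ y≈z) = inj₂ (+-congˡ y≈z)

  +-mono-≤ : ∀ {w x y z} → w ≤ x → y ≤ z → w + y ≤ x + z
  +-mono-≤ {w} {x} {y} {z} w≤x y≤z = begin
    w + y ≈⟨ +-comm w y ⟩
    y + w ≤⟨ +-monoʳ-≤ y w≤x ⟩
    y + x ≈⟨ +-comm y x ⟩
    x + y ≤⟨ +-monoʳ-≤ x y≤z ⟩
    x + z ∎

  +-monoˡ-≤ : ∀ x {y z} → y ≤ z → y + x ≤ z + x
  +-monoˡ-≤ x y≤z = +-mono-≤ y≤z ≤-refl

  x≤y+x : ∀ x {y} → 0# ≤ y → x ≤ y + x
  x≤y+x x {y} 0≤y = begin
    x      ≈⟨ +-identityˡ x ⟨
    0# + x ≤⟨ +-monoˡ-≤ x 0≤y ⟩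
    y + x  ∎

  x≤x+y : ∀ x {y} → 0# ≤ y → x ≤ x + y
  x≤x+y x {y} 0≤y = ≤-trans (x≤y+x x 0≤y) (≤-reflexive (+-comm y x))

  x-y+y≈x : ∀ x y → x - y + y ≈ x
  x-y+y≈x x y = begin-equality
    x - y + y     ≈⟨ +-assoc x (- y) y ⟩
    x + (- y + y) ≈⟨ +-congˡ (R.-‿inverseˡ y) ⟩
    x + 0#        ≈⟨ +-identityʳ x ⟩
    x             ∎

  x+y-y≈x : ∀ x y → x + y - y ≈ x
  x+y-y≈x x y = begin-equality
    x + y - y     ≈⟨ +-assoc x y (- y) ⟩
    x + (y - y)   ≈⟨ +-congˡ (R.-‿inverseʳ y) ⟩
    x + 0#        ≈⟨ +-identityʳ x ⟩
    x             ∎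

  +-cancelʳ-≤ : ∀ x {y z} → y + x ≤ z + x → y ≤ z
  +-cancelʳ-≤ x {y} {z} y+x≤z+x = begin
    y         ≈⟨ x+y-y≈x y x ⟨
    y + x - x ≤⟨ +-monoˡ-≤ (- x) y+x≤z+x ⟩
    z + x - x ≈⟨ x+y-y≈x z x ⟩
    z         ∎

  x≤y+z⇒x-z≤y : ∀ {x y} z → x ≤ y + z → x - z ≤ y
  x≤y+z⇒x-z≤y {x} z x≤y+z = +-cancelʳ-≤ z (≤-trans (≤-reflexive (x-y+y≈x x z)) x≤y+z)

  x+z≤y⇒x≤y-z : ∀ {x y} z → x + z ≤ y → x ≤ y - z
  x+z≤y⇒x≤y-z {x} {y} z x+z≤y = +-cancelʳ-≤ z (≤-trans x+z≤y (≤-reflexive (≈.sym (x-y+y≈x y z))))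

  -mono-≤ : ∀ {w x y z} → w ≤ x → z ≤ y → w - y ≤ x - z
  -mono-≤ {w} {x} {y} {z} w≤x z≤y = x≤y+z⇒x-z≤y y (begin
    w         ≤⟨ w≤x ⟩
    x         ≈⟨ x-y+y≈x x z ⟨
    x - z + z ≤⟨ +-monoʳ-≤ (x - z) z≤y ⟩
    x - z + y ∎)

  x≤y⇒x-y≤0 : ∀ {x y} → x ≤ y → x - y ≤ 0#
  x≤y⇒x-y≤0 {x} {y} x≤y = x≤y+z⇒x-z≤y y (≤-trans x≤y (≤-reflexive (≈.sym (+-identityˡ y))))

  x≤y⇒0≤y-x : ∀ {x y} → x ≤ y → 0# ≤ y - x
  x≤y⇒0≤y-x {x} x≤y = x+z≤y⇒x≤y-z x (≤-trans (≤-reflexive (+-identityˡ x)) x≤y)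

  0<y-x : ∀ {x y} → x < y → 0# < y - x
  0<y-x {x} {y} x<y = begin-strict
    0#      ≈⟨ R.-‿inverseˡ x ⟨
    - x + x <⟨ +-monoʳ-< (- x) x<y ⟩
    - x + y ≈⟨ +-comm (- x) y ⟩
    y - x   ∎

  *-monoʳ-< : ∀ {x y z} → 0# < z → x < y → z * x < z * y
  *-monoʳ-< {x} {y} {z} 0<z x<y = begin-strict
    z * x               ≈⟨ +-identityʳ _ ⟨
    z * x + 0#          <⟨ +-monoʳ-< (z * x) (*-pos 0<z (0<y-x x<y)) ⟩
    z * x + z * (y - x) ≈⟨ distribˡ z x (y - x) ⟨
    z * (x + (y - x))   ≈⟨ *-congˡ (+-comm x (y - x)) ⟩
    z * (y - x + x)     ≈⟨ *-congˡ (x-y+y≈x y x) ⟩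
    z * y               ∎

  *-monoʳ-≤ : ∀ {x y z} → 0# ≤ z → x ≤ y → z * x ≤ z * y
  *-monoʳ-≤ {x} {y} {z} _ (inj₂ x≈y) = inj₂ (*-congˡ x≈y)
  *-monoʳ-≤ {x} {y} {z} (inj₁ 0<z) (inj₁ x<y) = inj₁ (*-monoʳ-< 0<z x<y)
  *-monoʳ-≤ {x} {y} {z} (inj₂ 0≈z) (inj₁ _) = ≤-reflexive (begin-equality
    z * x  ≈⟨ *-congʳ 0≈z ⟨
    0# * x ≈⟨ zeroˡ x ⟩
    0#     ≈⟨ zeroˡ y ⟨
    0# * y ≈⟨ *-congʳ 0≈z ⟩
    z * y  ∎)

  *-monoˡ-≤ : ∀ {x y z} → 0# ≤ z → x ≤ y → x * z ≤ y * z
  *-monoˡ-≤ {x} {y} {z} 0≤z x≤y = begin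
    x * z ≈⟨ *-comm x z ⟩
    z * x ≤⟨ *-monoʳ-≤ 0≤z x≤y ⟩
    z * y ≈⟨ *-comm z y ⟩
    y * z ∎

  *-nonneg : ∀ {x y} → 0# ≤ x → 0# ≤ y → 0# ≤ x * y
  *-nonneg {x} 0≤x 0≤y = ≤-trans (≤-reflexive (≈.sym (zeroʳ x))) (*-monoʳ-≤ 0≤x 0≤y)

  *-nonpos : ∀ {x y} → 0# ≤ x → y ≤ 0# → x * y ≤ 0#
  *-nonpos {x} 0≤x y≤0 = ≤-trans (*-monoʳ-≤ 0≤x y≤0) (≤-reflexive (zeroʳ x))

  *-nonposˡ : ∀ {x y} → x ≤ 0# → 0# ≤ y → x * y ≤ 0#
  *-nonposˡ {x} {y} x≤0 0≤y = ≤-trans (*-monoˡ-≤ 0≤y x≤0) (≤-reflexive (zeroˡ y))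

  *-nonpos-nonpos : ∀ {x y} → x ≤ 0# → y ≤ 0# → 0# ≤ x * y
  *-nonpos-nonpos {x} {y} x≤0 y≤0 = begin
    0#            ≤⟨ *-nonneg (0≤- x≤0) (0≤- y≤0) ⟩
    - x * - y     ≈⟨ -‿distribˡ-* x (- y) ⟨
    - (x * - y)   ≈⟨ R.-‿cong (-‿distribʳ-* x y) ⟨
    - (- (x * y)) ≈⟨ -‿involutive (x * y) ⟩
    x * y         ∎
    where
    0≤- : ∀ {z} → z ≤ 0# → 0# ≤ - z
    0≤- {z} z≤0 = ≤-trans (x+z≤y⇒x≤y-z z (≤-trans (≤-reflexive (+-identityˡ z)) z≤0)) (≤-reflexive (+-identityˡ (- z)))

  0<⇒≉0 : ∀ {x} → 0# < x → ¬ x ≈ 0#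
  0<⇒≉0 0<x x≈0 = irrefl (≈.sym x≈0) 0<x

  0<⁻¹ : ∀ {x} → 0# < x → 0# < x ⁻¹
  0<⁻¹ {x} 0<x with 0# <? x ⁻¹
  ... | yes 0<x⁻¹ = 0<x⁻¹
  ... | no  0≮x⁻¹ = contradiction
    (≤-trans (≤-reflexive (≈.sym (*-inverse (0<⇒≉0 0<x)))) (*-nonpos (<⇒≤ 0<x) (≮⇒≥ 0≮x⁻¹)))
    (<⇒≱ 0<1)

  -- The branch that attains `x ⊓ y` carries the estimate. Together with `⊔-Lipschitz` this passes a
  -- common Lipschitz constant from the pieces of the potential to the potential.
  ⊓-Lipschitz : ∀ {x y x′ y′} z → x′ ≤ x + z → y′ ≤ y + z → x′ ⊓ y′ ≤ x ⊓ y + z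
  ⊓-Lipschitz {x} {y} {x′} {y′} z x′≤ y′≤ with ⊓-sel x y
  ... | inj₁ eq = ≤-trans (≤-trans (x⊓y≤x x′ y′) x′≤) (≤-reflexive (+-congʳ (≈.sym eq)))
  ... | inj₂ eq = ≤-trans (≤-trans (x⊓y≤y x′ y′) y′≤) (≤-reflexive (+-congʳ (≈.sym eq)))

  ⊔-Lipschitz : ∀ {x y x′ y′} z → x′ ≤ x + z → y′ ≤ y + z → x′ ⊔ y′ ≤ x ⊔ y + z
  ⊔-Lipschitz {x} {y} z x′≤ y′≤ = ⊔-lub
    (≤-trans x′≤ (+-monoˡ-≤ z (x≤x⊔y x y)))
    (≤-trans y′≤ (+-monoˡ-≤ z (y≤x⊔y x y)))

  -- Division by `c` turns `v` into a lower bound of `P`. An estimate proved for every schedule is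
  -- thereby carried over to the optimum, which is defined as an infimum.
  infimum-scale : ∀ {P : Carrier → Set ℓ} {i c v} → 0# < c → Infimum P i →
                  (∀ x → P x → v ≤ c * x) → v ≤ c * i
  infimum-scale {P} {i} {c} {v} 0<c (_ , greatest) v≤ = begin
    v              ≈⟨ cancel v ⟨
    c * (c ⁻¹ * v) ≤⟨ *-monoʳ-≤ (<⇒≤ 0<c) (greatest (c ⁻¹ * v) below) ⟩
    c * i          ∎
    where
    cancel : ∀ x → c * (c ⁻¹ * x) ≈ x
    cancel x = begin-equality
      c * (c ⁻¹ * x) ≈⟨ *-assoc c (c ⁻¹) x ⟨
      c * c ⁻¹ * x   ≈⟨ *-congʳ (*-inverse (0<⇒≉0 0<c)) ⟩
      1# * x         ≈⟨ *-identityˡ x ⟩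
      x              ∎
    below : LowerBound P (c ⁻¹ * v)
    below x Px = begin
      c ⁻¹ * v       ≤⟨ *-monoʳ-≤ (<⇒≤ (0<⁻¹ 0<c)) (v≤ x Px) ⟩
      c ⁻¹ * (c * x) ≈⟨ solve 3 (λ a b x → a :* (b :* x) := b :* (a :* x)) ≈.refl (c ⁻¹) c x ⟩
      c * (c ⁻¹ * x) ≈⟨ cancel x ⟩
      x              ∎

-- Integer powers of `r` and the geometric shells.

module Powers {ℓ} (ℝ : RealNumbers ℓ) (r : RealNumbers.Carrier ℝ)
              (1<r : RealNumbers._<_ ℝ (RealNumbers.1# ℝ) r) where
  open RealNumbers ℝ
  open RealProperties ℝ

  0<r : 0# < r
  0<r = <-trans 0<1 1<r

  ^-pos : ∀ {x} n → 0# < x → 0# < x ^ n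
  ^-pos zero    _   = 0<1
  ^-pos (suc n) 0<x = *-pos 0<x (^-pos n 0<x)

  ^ᶻ-pos : ∀ n → 0# < r ^ᶻ n
  ^ᶻ-pos (+ n)    = ^-pos n 0<r
  ^ᶻ-pos -[1+ n ] = ^-pos (suc n) (0<⁻¹ 0<r)

  ^ᶻ-suc : ∀ n → r ^ᶻ ℤ.suc n ≈ r * r ^ᶻ n
  ^ᶻ-suc (+ n)        = ≈.refl
  ^ᶻ-suc -[1+ zero ]  = ≈.sym (≈.trans (*-congˡ (*-identityʳ (r ⁻¹))) (*-inverse (0<⇒≉0 0<r)))
  ^ᶻ-suc -[1+ suc n ] = begin-equality
    (r ⁻¹) ^ suc n              ≈⟨ *-identityˡ _ ⟨
    1# * (r ⁻¹) ^ suc n         ≈⟨ *-congʳ (*-inverse (0<⇒≉0 0<r)) ⟨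
    r * r ⁻¹ * (r ⁻¹) ^ suc n   ≈⟨ *-assoc r (r ⁻¹) _ ⟩
    r * (r ⁻¹) ^ suc (suc n)    ∎

  ^ᶻ-step : ∀ n → r ^ᶻ n ≤ r ^ᶻ ℤ.suc n
  ^ᶻ-step n = begin
    r ^ᶻ n       ≈⟨ *-identityˡ _ ⟨
    1# * r ^ᶻ n  ≤⟨ *-monoˡ-≤ (<⇒≤ (^ᶻ-pos n)) (<⇒≤ 1<r) ⟩
    r * r ^ᶻ n   ≈⟨ ^ᶻ-suc n ⟨
    r ^ᶻ ℤ.suc n ∎

  ^ᶻ-shift : ∀ j n → r ^ᶻ n ≤ r ^ᶻ (+ j ℤ.+ n)
  ^ᶻ-shift zero    n = ≤-reflexive (≈.reflexive (≡.cong (r ^ᶻ_) (≡.sym (ℤ.+-identityˡ n))))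
  ^ᶻ-shift (suc j) n = begin
    r ^ᶻ n                 ≤⟨ ^ᶻ-shift j n ⟩
    r ^ᶻ (+ j ℤ.+ n)       ≤⟨ ^ᶻ-step (+ j ℤ.+ n) ⟩
    r ^ᶻ ℤ.suc (+ j ℤ.+ n) ≡⟨ ≡.cong (r ^ᶻ_) (ℤ.suc-+ j n) ⟨
    r ^ᶻ (+ suc j ℤ.+ n)   ∎

  ^ᶻ-mono : ∀ {m n} → m ℤ.≤ n → r ^ᶻ m ≤ r ^ᶻ n
  ^ᶻ-mono {m} {n} m≤n = begin
    r ^ᶻ m                           ≤⟨ ^ᶻ-shift ℤ.∣ n ℤ.- m ∣ m ⟩
    r ^ᶻ (+ ℤ.∣ n ℤ.- m ∣ ℤ.+ m)     ≡⟨ ≡.cong (λ k → r ^ᶻ (k ℤ.+ m)) (ℤ.0≤i⇒+∣i∣≡i (ℤ.i≤j⇒0≤j-i m≤n)) ⟩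
    r ^ᶻ (n ℤ.- m ℤ.+ m)             ≡⟨ ≡.cong (r ^ᶻ_) (n-m+m≡n) ⟩
    r ^ᶻ n                           ∎
    where
    n-m+m≡n : n ℤ.- m ℤ.+ m ≡ n
    n-m+m≡n = ≡.trans (ℤ.+-assoc n (ℤ.- m) m)
      (≡.trans (≡.cong (λ k → n ℤ.+ k) (ℤ.+-inverseˡ m)) (ℤ.+-identityʳ n))

  InShell : ℤ → Carrier → Set ℓ
  InShell n t = r ^ᶻ n ≤ t × t < r ^ᶻ ℤ.suc n

  inShell? : ∀ n t → Dec (InShell n t)
  inShell? n t = (r ^ᶻ n ≤? t) ×-dec (t <? r ^ᶻ ℤ.suc n)

  InShell-resp-≈ : ∀ n {t u} → t ≈ u → InShell n t → InShell n u
  InShell-resp-≈ n t≈u (lo , hi) = ≤-respʳ-≈ t≈u lo , <-respˡ-≈ t≈u hi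

  -- For `m < n`, the outer radius of shell `m` is at most the inner radius of shell `n`.
  shell-unique : ∀ m n {t} → InShell m t → InShell n t → m ≡ n
  shell-unique m n (rᵐ≤t , t<rᵐ⁺¹) (rⁿ≤t , t<rⁿ⁺¹) with ℤ.<-cmp m n
  ... | tri≈ _ m≡n _ = m≡n
  ... | tri< m<n _ _ = contradiction (≤-trans (^ᶻ-mono (ℤ.i<j⇒suc[i]≤j m<n)) rⁿ≤t) (<⇒≱ t<rᵐ⁺¹)
  ... | tri> _ _ n<m = contradiction (≤-trans (^ᶻ-mono (ℤ.i<j⇒suc[i]≤j n<m)) rᵐ≤t) (<⇒≱ t<rⁿ⁺¹)

  1≤^ : ∀ n → 1# ≤ r ^ n
  1≤^ n = ≤-trans (^ᶻ-shift n (+ 0)) (≤-reflexive (≈.reflexive (≡.cong (r ^ᶻ_) (ℤ.+-identityʳ (+ n)))))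

  q : Carrier
  q = (r - 1#) ⁻¹

  0<r-1 : 0# < r - 1#
  0<r-1 = 0<y-x 1<r

  0<q : 0# < q
  0<q = 0<⁻¹ 0<r-1

  r-1*q≈1 : (r - 1#) * q ≈ 1#
  r-1*q≈1 = *-inverse (0<⇒≉0 0<r-1)

  bernoulli : ∀ n → (r - 1#) * (n · 1#) + 1# ≤ r ^ n
  bernoulli zero    = ≤-reflexive (≈.trans (+-congʳ (zeroʳ _)) (+-identityˡ 1#))
  bernoulli (suc n) = begin
    (r - 1#) * (1# + n · 1#) + 1#              ≈⟨ solve 2 (λ a b → a :* (con 1 :+ b) :+ con 1 := a :* con 1 :+ (a :* b :+ con 1))
                                                    ≈.refl (r - 1#) (n · 1#) ⟩
    (r - 1#) * 1# + ((r - 1#) * (n · 1#) + 1#) ≤⟨ +-mono-≤ (*-monoʳ-≤ (<⇒≤ 0<r-1) (1≤^ n)) (bernoulli n) ⟩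
    (r - 1#) * r ^ n + r ^ n                 ≈⟨ solve 2 (λ a b → a :* b :+ b := (a :+ con 1) :* b) ≈.refl (r - 1#) (r ^ n) ⟩
    (r - 1# + 1#) * r ^ n                    ≈⟨ *-congʳ (x-y+y≈x r 1#) ⟩
    r * r ^ n                                ∎

  -- The Archimedean property at `x / (r - 1)`, followed by Bernoulli's inequality.
  ^-unbounded : ∀ x → ∃ λ n → x < r ^ n
  ^-unbounded x with archimedean (x * q)
  ... | n , xq<n = n , (begin-strict
    x                       ≈⟨ *-identityʳ x ⟨
    x * 1#                  ≈⟨ *-congˡ r-1*q≈1 ⟨
    x * ((r - 1#) * q)      ≈⟨ solve 3 (λ x a q → x :* (a :* q) := a :* (x :* q)) ≈.refl x (r - 1#) q ⟩
    (r - 1#) * (x * q)      <⟨ *-monoʳ-< 0<r-1 xq<n ⟩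
    (r - 1#) * (n · 1#)     ≤⟨ x≤x+y _ (<⇒≤ 0<1) ⟩
    (r - 1#) * (n · 1#) + 1# ≤⟨ bernoulli n ⟩
    r ^ n                   ∎)

  ⁻¹^*^≈1 : ∀ n → (r ⁻¹) ^ n * r ^ n ≈ 1#
  ⁻¹^*^≈1 zero    = *-identityʳ 1#
  ⁻¹^*^≈1 (suc n) = begin-equality
    r ⁻¹ * (r ⁻¹) ^ n * (r * r ^ n)     ≈⟨ solve 4 (λ a b c d → a :* b :* (c :* d) := c :* a :* (b :* d)) ≈.refl (r ⁻¹) _ r _ ⟩
    r * r ⁻¹ * ((r ⁻¹) ^ n * r ^ n)     ≈⟨ *-cong (*-inverse (0<⇒≉0 0<r)) (⁻¹^*^≈1 n) ⟩
    1# * 1#                             ≈⟨ *-identityʳ 1# ⟩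
    1#                                  ∎

  ^ᶻ-arbitrarily-small : ∀ {t} → 0# < t → ∃ λ n → r ^ᶻ -[1+ n ] ≤ t
  ^ᶻ-arbitrarily-small {t} 0<t with ^-unbounded (t ⁻¹)
  ... | n , t⁻¹<rⁿ = n , (begin
    y                  ≈⟨ *-identityʳ y ⟨
    y * 1#             ≈⟨ *-congˡ (*-inverse (0<⇒≉0 0<t)) ⟨
    y * (t * t ⁻¹)     ≈⟨ *-assoc y t (t ⁻¹) ⟨
    -- The exponent `-[1+ n ]` is `-(n + 1)`, so the bound by `r ^ n` is first raised to
    -- `r ^ suc n`, the inverse of `y`.
    y * t * t ⁻¹       ≤⟨ *-monoʳ-≤ (<⇒≤ (*-pos (^ᶻ-pos -[1+ n ]) 0<t)) (≤-trans (<⇒≤ t⁻¹<rⁿ) (^ᶻ-step (+ n))) ⟩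
    y * t * r ^ suc n  ≈⟨ solve 3 (λ y t z → y :* t :* z := t :* (y :* z)) ≈.refl y t _ ⟩
    t * (y * r ^ suc n) ≈⟨ *-congˡ (⁻¹^*^≈1 (suc n)) ⟩
    t * 1#             ≈⟨ *-identityʳ t ⟩
    t                  ∎)
    where y = r ^ᶻ -[1+ n ]

  -- A downward search, starting at the outermost of the `j` consecutive shells above `r ^ᶻ m`.
  shell-between : ∀ {t} j m → r ^ᶻ m ≤ t → t < r ^ᶻ (+ j ℤ.+ m) → ∃ λ n → InShell n t
  shell-between zero    m rᵐ≤t t<rᵐ = contradiction rᵐ≤t
    (<⇒≱ (<-respʳ-≈ (≈.reflexive (≡.cong (r ^ᶻ_) (ℤ.+-identityˡ m))) t<rᵐ))
  shell-between {t} (suc j) m rᵐ≤t t<r with t <? r ^ᶻ (+ j ℤ.+ m)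
  ... | yes t<r′ = shell-between j m rᵐ≤t t<r′
  ... | no  t≮r′ = + j ℤ.+ m , ≮⇒≥ t≮r′ ,
    <-respʳ-≈ (≈.reflexive (≡.cong (r ^ᶻ_) (ℤ.suc-+ j m))) t<r

  shell-exists : ∀ {t} → 0# < t → ∃ λ n → InShell n t
  shell-exists {t} 0<t with ^ᶻ-arbitrarily-small 0<t | ^-unbounded t
  -- From exponent `-(m + 1)` up to exponent `n` there are `n + (m + 1)` shells.
  ... | m , lo | n , hi = shell-between (n ℕ.+ suc m) -[1+ m ] lo
    (<-respʳ-≈ (≈.reflexive (≡.cong (r ^ᶻ_) (≡.sym n+1+m-1-m))) hi)
    where
    n+1+m-1-m : + (n ℕ.+ suc m) ℤ.+ -[1+ m ] ≡ + n
    n+1+m-1-m = ≡.trans (ℤ.+-assoc (+ n) (+ suc m) -[1+ m ])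
      (≡.trans (≡.cong (λ k → + n ℤ.+ k) (ℤ.+-inverseʳ (+ suc m))) (ℤ.+-identityʳ (+ n)))

-- Finite sums indexed by lists.

module FiniteSums {ℓ} (ℝ : RealNumbers ℓ) {a} {A : Set a} where
  open RealNumbers ℝ
  open RealProperties ℝ

  ∑ : List A → (A → Carrier) → Carrier
  ∑ []       f = 0#
  ∑ (k ∷ ks) f = f k + ∑ ks f

  ∑-mono : ∀ ks {f g} → (∀ {k} → k ∈ ks → f k ≤ g k) → ∑ ks f ≤ ∑ ks g
  ∑-mono []       f≤g = ≤-refl
  ∑-mono (k ∷ ks) f≤g = +-mono-≤ (f≤g (here refl)) (∑-mono ks (f≤g ∘ there))

  ∑-nonpos : ∀ ks {f} → (∀ k → f k ≤ 0#) → ∑ ks f ≤ 0#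
  ∑-nonpos []       f≤0 = ≤-refl
  ∑-nonpos (k ∷ ks) f≤0 = ≤-trans (+-mono-≤ (f≤0 k) (∑-nonpos ks f≤0)) (≤-reflexive (+-identityʳ 0#))

  ∑-nonneg : ∀ ks {f} → (∀ k → 0# ≤ f k) → 0# ≤ ∑ ks f
  ∑-nonneg []       0≤f = ≤-refl
  ∑-nonneg (k ∷ ks) 0≤f = +-nonneg (0≤f k) (∑-nonneg ks 0≤f)

  ∑-+ : ∀ ks f g → ∑ ks (λ k → f k + g k) ≈ ∑ ks f + ∑ ks g
  ∑-+ []       f g = ≈.sym (+-identityʳ 0#)
  ∑-+ (k ∷ ks) f g = ≈.trans (+-congˡ (∑-+ ks f g))
    (solve 4 (λ a b c d → (a :+ b) :+ (c :+ d) := (a :+ c) :+ (b :+ d)) ≈.refl (f k) (g k) _ _)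

  ∑-*ˡ : ∀ ks x f → ∑ ks (λ k → x * f k) ≈ x * ∑ ks f
  ∑-*ˡ []       x f = ≈.sym (zeroʳ x)
  ∑-*ˡ (k ∷ ks) x f = ≈.trans (+-congˡ (∑-*ˡ ks x f)) (≈.sym (distribˡ x _ _))

  -- As `ks` has no repetitions, `x` and `y` are settled at the only occurrence of `k`, and `f` is
  -- compared with `g` everywhere else. This serves the steps in which a single server or annulus
  -- pays.
  ∑-exchange : ∀ {ks k f g} x y → Unique ks → k ∈ ks → (∀ j → j ≢ k → f j ≤ g j) →
               x + f k ≤ y + g k → x + ∑ ks f ≤ y + ∑ ks g
  ∑-exchange {k ∷ ks} {f = f} {g} x y (k∉ks ∷ _) (here refl) f≤g at-k = begin
    x + (f k + ∑ ks f) ≈⟨ +-assoc x _ _ ⟨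
    x + f k + ∑ ks f   ≤⟨ +-mono-≤ at-k (∑-mono ks (λ {j} j∈ks → f≤g j (All.lookup k∉ks j∈ks ∘ ≡.sym))) ⟩
    y + g k + ∑ ks g   ≈⟨ +-assoc y _ _ ⟩
    y + (g k + ∑ ks g) ∎
  ∑-exchange {j ∷ ks} {f = f} {g} x y (j∉ks ∷ unique) (there k∈ks) f≤g at-k = begin
    x + (f j + ∑ ks f) ≈⟨ swap x (f j) (∑ ks f) ⟩
    f j + (x + ∑ ks f) ≤⟨ +-mono-≤ (f≤g j (All.lookup j∉ks k∈ks)) (∑-exchange x y unique k∈ks f≤g at-k) ⟩
    g j + (y + ∑ ks g) ≈⟨ swap y (g j) (∑ ks g) ⟨
    y + (g j + ∑ ks g) ∎
    where
    swap : ∀ a b c → a + (b + c) ≈ b + (a + c)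
    swap = solve 3 (λ a b c → a :+ (b :+ c) := b :+ (a :+ c)) ≈.refl

  -- `P` holds at no more than one index, and each index occurs at most once, so the surplus `x` is
  -- spent at most once.
  ∑-bump : ∀ {p} {P : A → Set p} {ks f g x} → Unique ks → (∀ {j k} → P j → P k → j ≡ k) → 0# ≤ x →
           (∀ k → f k ≤ g k ⊎ P k × f k ≤ x + g k) → ∑ ks f ≤ x + ∑ ks g
  ∑-bump {ks = []} _ _ 0≤x _ = ≤-trans 0≤x (x≤x+y _ ≤-refl)
  ∑-bump {P = P} {ks = k ∷ ks} {f} {g} {x} (k∉ks ∷ unique) P-unique 0≤x f≤ with f≤ k
  ... | inj₁ fk≤gk = begin
    f k + ∑ ks f       ≤⟨ +-mono-≤ fk≤gk (∑-bump unique P-unique 0≤x f≤) ⟩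
    g k + (x + ∑ ks g) ≈⟨ solve 3 (λ a b c → a :+ (b :+ c) := b :+ (a :+ c)) ≈.refl (g k) x _ ⟩
    x + (g k + ∑ ks g) ∎
  ... | inj₂ (Pk , fk≤x+gk) = begin
    f k + ∑ ks f       ≤⟨ +-mono-≤ fk≤x+gk (∑-mono ks rest) ⟩
    x + g k + ∑ ks g   ≈⟨ +-assoc x _ _ ⟩
    x + (g k + ∑ ks g) ∎
    where
    rest : ∀ {j} → j ∈ ks → f j ≤ g j
    rest {j} j∈ks with f≤ j
    ... | inj₁ fj≤gj    = fj≤gj
    ... | inj₂ (Pj , _) = contradiction (P-unique Pk Pj) (All.lookup k∉ks j∈ks)

-- Injective numbering of disjoint server pools.

module Pairing where
  open import Data.Nat.Base using (_+_; _*_; _<_)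

  -- pair m n lies in [t², (t + 1)²) for t = m + n, hence determines first t and then m.
  pair : ℕ → ℕ → ℕ
  pair m n = (m + n) * (m + n) + m

  pair-< : ∀ m n m′ n′ → m + n < m′ + n′ → pair m n < pair m′ n′
  pair-< m n m′ n′ t<t′ = begin-strict
    t * t + m             ≤⟨ ℕ.+-monoʳ-≤ (t * t) (ℕ.m≤m+n m n) ⟩
    t * t + t             ≡⟨ ℕ.+-comm (t * t) t ⟩
    suc t * t             <⟨ ℕ.*-monoʳ-< (suc t) (ℕ.n<1+n t) ⟩
    suc t * suc t         ≤⟨ ℕ.*-mono-≤ t<t′ t<t′ ⟩
    (m′ + n′) * (m′ + n′) ≤⟨ ℕ.m≤m+n _ m′ ⟩
    pair m′ n′            ∎
    where
    open ℕ.≤-Reasoning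
    t = m + n

  pair-injective : ∀ m n m′ n′ → pair m n ≡ pair m′ n′ → m ≡ m′ × n ≡ n′
  pair-injective m n m′ n′ eq with ℕ.<-cmp (m + n) (m′ + n′)
  ... | tri< t<t′ _ _ = contradiction eq (ℕ.<⇒≢ (pair-< m n m′ n′ t<t′))
  ... | tri> _ _ t′<t = contradiction (≡.sym eq) (ℕ.<⇒≢ (pair-< m′ n′ m n t′<t))
  ... | tri≈ _ t≡t′ _ = m≡m′ , ℕ.+-cancelˡ-≡ m n n′ (≡.trans t≡t′ (≡.cong (_+ n′) (≡.sym m≡m′)))
    where
    m≡m′ : m ≡ m′
    m≡m′ = ℕ.+-cancelˡ-≡ ((m + n) * (m + n)) m m′
      (≡.trans eq (≡.cong (λ t → t * t + m′) (≡.sym t≡t′)))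

  code : ℤ → ℕ
  code (+ n)    = pair 0 n
  code -[1+ n ] = pair 1 n

  code-injective : ∀ m n → code m ≡ code n → m ≡ n
  code-injective (+ m)    (+ n)    eq = ≡.cong +_ (proj₂ (pair-injective 0 m 0 n eq))
  code-injective (+ m)    -[1+ n ] eq with () ← proj₁ (pair-injective 0 m 1 n eq)
  code-injective -[1+ m ] (+ n)    eq with () ← proj₁ (pair-injective 1 m 0 n eq)
  code-injective -[1+ m ] -[1+ n ] eq = ≡.cong -[1+_] (proj₂ (pair-injective 1 m 1 n eq))

  poolServer : ℤ → ℕ → ℕ
  poolServer n = pair (code n)

  -- The first components 0 and 1 in `code` encode the sign of an integer. With 2 in their place,
  -- this server belongs to no pool.
  sourceServer : ℕ
  sourceServer = pair (pair 2 0) 0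

  source≢pool : ∀ n j → sourceServer ≢ poolServer n j
  source≢pool n j eq with n | proj₁ (pair-injective (pair 2 0) 0 (code n) j eq)
  ... | + m      | eq′ with () ← proj₁ (pair-injective 2 0 0 m eq′)
  ... | -[1+ m ] | eq′ with () ← proj₁ (pair-injective 2 0 1 m eq′)

-- Basic facts on optima and moves.

module ServerProperties {ℓ a e} (ℝ : RealNumbers ℓ) (M : MetricSpace ℝ a e) (s : MetricSpace.Point M) where
  open RealNumbers ℝ
  open RealProperties ℝ
  open InfiniteServer ℝ M s

  OPT-nonneg : ∀ σ → 0# ≤ OPT σ
  OPT-nonneg σ = proj₂ (OPT-infimum σ) 0#
    λ { x (is , x≈) → ≤-respʳ-≈ (≈.sym x≈) (costFrom-nonneg initial σ is) }

  move-≡ : ∀ C i {p} → move i p C i ≡ p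
  move-≡ C i {p} = ≡.cong (if_then p else C i) (dec-true (i ℕ.≟ i) refl)

  move-≢ : ∀ C {i j p} → j ≢ i → move i p C j ≡ C j
  move-≢ C {i} {j} {p} j≢i = ≡.cong (if_then p else C j) (dec-false (j ℕ.≟ i) j≢i)

-- Decomposition of requests and costs into shells.

module Shells {ℓ a e} (ℝ : RealNumbers ℓ)
              (M : MetricSpace ℝ a e) (s : MetricSpace.Point M)
              (r : RealNumbers.Carrier ℝ) (1<r : RealNumbers._<_ ℝ (RealNumbers.1# ℝ) r) where
  open RealNumbers ℝ
  open RealProperties ℝ public
  open Powers ℝ r 1<r public
  open MetricSpace M using (Point; d; nonNegative; triangle)
  open InfiniteServer ℝ M s
  module Server n = InfiniteServer ℝ (annulus ℝ M s r n) (source ℝ M s r n)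

  AnnulusPoint : ℤ → Set _
  AnnulusPoint n = MetricSpace.Point (annulus ℝ M s r n)

  -- The decision is an argument, so that facts about restricted sequences can be proved for an
  -- arbitrary decision by cases.
  consIf : ∀ {n p} → Dec (InShell n (d s p)) → List (AnnulusPoint n) → List (AnnulusPoint n)
  consIf {p = p} (yes p∈n) ps = (p , inj₂ p∈n) ∷ ps
  consIf         (no  _)   ps = ps

  -- The test is for the shell, not the annulus: requests at `s` belong to every annulus but to no
  -- shell and are dropped. Hence each request survives in at most one restriction.
  restrict : ∀ n → List Point → List (AnnulusPoint n)
  restrict n []      = []
  restrict n (p ∷ σ) = consIf {n} (inShell? n (d s p)) (restrict n σ)

  chargeIf : ∀ {p} {P : Set p} → Dec P → Carrier → Carrier
  chargeIf (yes _) x = x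
  chargeIf (no _)  x = 0#

  chargeIf-nonneg : ∀ {p} {P : Set p} (P? : Dec P) {x} → 0# ≤ x → 0# ≤ chargeIf P? x
  chargeIf-nonneg (yes _) 0≤x = 0≤x
  chargeIf-nonneg (no _)  _   = ≤-refl

  chargeIf-yes : ∀ {p} {P : Set p} (P? : Dec P) {x} → P → x ≤ chargeIf P? x
  chargeIf-yes (yes _) _  = ≤-refl
  chargeIf-yes (no ¬P) Px = contradiction Px ¬P

  -- A move is booked under the shell of its endpoint alone, wherever it starts.
  costInto : ℤ → Configuration → (σ : List Point) → Schedule σ → Carrier
  costInto k C []      []       = 0#
  costInto k C (p ∷ σ) (i ∷ is) =
    chargeIf (inShell? k (d s p)) (d (C i) p) + costInto k (move i p C) σ is

  open FiniteSums ℝ public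

  -- Shells are disjoint, so by `∑-bump` each move is booked for at most one `k`. The injection `g`
  -- covers the shifts to the neighbouring annuli.
  ∑-costInto : ∀ {ks} (g : ℤ → ℤ) → Unique ks → (∀ {j k} → g j ≡ g k → j ≡ k) →
               ∀ C σ is → ∑ ks (λ k → costInto (g k) C σ is) ≤ costFrom C σ is
  ∑-costInto {ks} g unique g-injective C []      []       = ∑-nonpos ks (λ _ → ≤-refl)
  ∑-costInto {ks} g unique g-injective C (p ∷ σ) (i ∷ is) = ≤-trans
    (∑-bump unique (λ {j} {k} p∈j p∈k → g-injective (shell-unique (g j) (g k) p∈j p∈k)) nonNegative step)
    (+-monoʳ-≤ (d (C i) p) (∑-costInto g unique g-injective (move i p C) σ is))
    where
    step : ∀ k → costInto (g k) C (p ∷ σ) (i ∷ is) ≤ costInto (g k) (move i p C) σ is ⊎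
                 InShell (g k) (d s p) ×
                 costInto (g k) C (p ∷ σ) (i ∷ is) ≤ d (C i) p + costInto (g k) (move i p C) σ is
    step k with inShell? (g k) (d s p)
    ... | yes p∈k = inj₂ (p∈k , ≤-refl)
    ... | no  _   = inj₁ (≤-reflexive (+-identityˡ _))

  -- This is r / (r - 1).
  K : Carrier
  K = 1# + q

  1≤K : 1# ≤ K
  1≤K = x≤x+y 1# (<⇒≤ 0<q)

  0≤K : 0# ≤ K
  0≤K = ≤-trans (<⇒≤ 0<1) 1≤K

  K*≈ : ∀ x → K * x ≈ x + q * x
  K*≈ x = ≈.trans (distribʳ x 1# q) (+-congʳ (*-identityˡ x))

  -- The shell with inner radius `x` has width `r * x - x`, and the factor `1 / (r - 1)` turns this
  -- width back into the radius. The choice of `K` rests on this.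
  q*[rx-x]≈x : ∀ x → q * (r * x - x) ≈ x
  q*[rx-x]≈x x = begin-equality
    q * (r * x - x)                ≈⟨ *-congˡ (+-congʳ (*-congʳ (x-y+y≈x r 1#))) ⟨
    q * ((r - 1# + 1#) * x - x)    ≈⟨ *-congˡ (+-congʳ (solve 2 (λ a x → (a :+ con 1) :* x := a :* x :+ x) ≈.refl (r - 1#) x)) ⟩
    q * ((r - 1#) * x + x - x)     ≈⟨ *-congˡ (x+y-y≈x _ x) ⟩
    q * ((r - 1#) * x)             ≈⟨ solve 3 (λ q a x → q :* (a :* x) := a :* q :* x) ≈.refl q (r - 1#) x ⟩
    (r - 1#) * q * x               ≈⟨ *-congʳ r-1*q≈1 ⟩
    1# * x                         ≈⟨ *-identityˡ x ⟩
    x                              ∎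

  -- Writing `r` as `(r - 1) + 1` turns `4r - 1` into `4(r - 1) + 3`, and multiplication by `q`
  -- gives `4 + 3q = 3(1 + q) + 1`.
  competitiveRatio≈ : (4 · r - 1#) * q ≈ K + K + K + 1#
  competitiveRatio≈ = begin-equality
    (4 · r - 1#) * q                   ≈⟨ *-congʳ (+-congʳ (+-cong r≈ (+-cong r≈ (+-cong r≈ (+-congʳ r≈))))) ⟩
    (4 · (r - 1# + 1#) - 1#) * q       ≈⟨ *-congʳ (+-congʳ (solve 1 (λ t → let t+1 = t :+ con 1 in
                                            t+1 :+ (t+1 :+ (t+1 :+ (t+1 :+ con 0))) := four t :+ three (con 1) :+ con 1)
                                            ≈.refl (r - 1#))) ⟩
    (_ + 1# - 1#) * q                  ≈⟨ *-congʳ (x+y-y≈x _ 1#) ⟩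
    _ * q                              ≈⟨ solve 2 (λ t q → (four t :+ three (con 1)) :* q := four (t :* q) :+ three q) ≈.refl (r - 1#) q ⟩
    _                                  ≈⟨ +-congʳ (+-cong (+-cong (+-cong r-1*q≈1 r-1*q≈1) r-1*q≈1) r-1*q≈1) ⟩
    1# + 1# + 1# + 1# + (q + q + q)    ≈⟨ solve 1 (λ q → four (con 1) :+ three q := three (con 1 :+ q) :+ con 1) ≈.refl q ⟩
    K + K + K + 1#                     ∎
    where
    r≈ : r ≈ r - 1# + 1#
    r≈ = ≈.sym (x-y+y≈x r 1#)
    three four : ∀ {n} → Polynomial n → Polynomial n
    three x = x :+ x :+ x
    four x  = x :+ x :+ x :+ x

  -- The potential of one annulus.

  module Potential (n : ℤ) where
    lower upper : Carrier
    lower = r ^ᶻ ℤ.pred n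
    upper = r ^ᶻ ℤ.suc (ℤ.suc n)

    -- The first argument is the position of a server of the given schedule, the second that of its
    -- copy.
    potential : Point → Point → Carrier
    potential x c = 0# ⊔ (d c x ⊓ ((K * (d s x - lower)) ⊓ (K * (upper - d s x))))

    potential-nonneg : ∀ x c → 0# ≤ potential x c
    potential-nonneg x c = x≤x⊔y 0# _

    -- By the triangle inequality each term of the minimum grows by at most `K * d x y`; for the
    -- distance to the copy, `1 ≤ K` enters. Minimum and maximum preserve this.
    potential-Lipschitz : ∀ x y c → potential y c ≤ potential x c + K * d x y
    potential-Lipschitz x y c = ⊔-Lipschitz (K * δ) (x≤x+y 0# 0≤Kδ)
      (⊓-Lipschitz (K * δ) direct (⊓-Lipschitz (K * δ) fromBelow fromAbove))
      where
      δ = d x y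
      0≤Kδ : 0# ≤ K * δ
      0≤Kδ = *-nonneg 0≤K nonNegative
      direct : d c y ≤ d c x + K * δ
      direct = begin
        d c y          ≤⟨ triangle c x y ⟩
        d c x + δ      ≈⟨ +-congˡ (*-identityˡ δ) ⟨
        d c x + 1# * δ ≤⟨ +-monoʳ-≤ (d c x) (*-monoˡ-≤ nonNegative 1≤K) ⟩
        d c x + K * δ  ∎
      fromBelow : K * (d s y - lower) ≤ K * (d s x - lower) + K * δ
      fromBelow = begin
        K * (d s y - lower)         ≤⟨ *-monoʳ-≤ 0≤K (x≤y+z⇒x-z≤y lower (begin
          d s y                       ≤⟨ triangle s x y ⟩
          d s x + δ                   ≈⟨ +-congʳ (x-y+y≈x (d s x) lower) ⟨
          d s x - lower + lower + δ   ≈⟨ solve 3 (λ x y z → x :+ y :+ z := x :+ z :+ y) ≈.refl _ lower δ ⟩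
          d s x - lower + δ + lower   ∎)) ⟩
        K * (d s x - lower + δ)     ≈⟨ distribˡ K _ δ ⟩
        K * (d s x - lower) + K * δ ∎
      fromAbove : K * (upper - d s y) ≤ K * (upper - d s x) + K * δ
      fromAbove = begin
        K * (upper - d s y)         ≤⟨ *-monoʳ-≤ 0≤K (x≤y+z⇒x-z≤y (d s y) (begin
          upper                         ≈⟨ x-y+y≈x upper (d s x) ⟨
          upper - d s x + d s x         ≤⟨ +-monoʳ-≤ _ (triangle s y x) ⟩
          upper - d s x + (d s y + d y x) ≈⟨ +-congˡ (+-congˡ (MetricSpace.sym M y x)) ⟩
          upper - d s x + (d s y + δ)   ≈⟨ solve 3 (λ x y z → x :+ (y :+ z) := x :+ z :+ y) ≈.refl _ (d s y) δ ⟩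
          upper - d s x + δ + d s y     ∎)) ⟩
        K * (upper - d s x + δ)     ≈⟨ distribˡ K _ δ ⟩
        K * (upper - d s x) + K * δ ∎

    -- At or beyond one of the two radii, the corresponding boundary term is nonpositive, and with
    -- it the minimum.
    potential-far : ∀ {p} c → d s p ≤ lower ⊎ upper ≤ d s p → potential p c ≤ 0#
    potential-far c (inj₁ p≤) = ⊔-lub ≤-refl
      (≤-trans (x⊓y≤y _ _) (≤-trans (x⊓y≤x _ _) (*-nonpos 0≤K (x≤y⇒x-y≤0 p≤))))
    potential-far c (inj₂ ≤p) = ⊔-lub ≤-refl
      (≤-trans (x⊓y≤y _ _) (≤-trans (x⊓y≤y _ _) (*-nonpos 0≤K (x≤y⇒x-y≤0 ≤p))))

    potential-self : ∀ p → potential p p ≤ 0#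
    potential-self p = ⊔-lub ≤-refl
      (≤-trans (x⊓y≤x _ _) (≤-reflexive (MetricSpace.≈⇒0 M (MetricSpace.EqC.refl M))))

    r*lower≈rⁿ : r * lower ≈ r ^ᶻ n
    r*lower≈rⁿ = ≈.trans (≈.sym (^ᶻ-suc (ℤ.pred n))) (≈.reflexive (≡.cong (r ^ᶻ_) (ℤ.suc-pred n)))

    -- `t` exceeds `lower` by at least the width of shell `n - 1`, and `q` times that width is
    -- `lower`; adding `t - lower` gives `t`.
    shell-below : ∀ {t} → InShell n t → t ≤ K * (t - lower)
    shell-below {t} (rⁿ≤t , _) = begin
      t                                   ≈⟨ x-y+y≈x t lower ⟨
      t - lower + lower                   ≈⟨ +-congˡ (q*[rx-x]≈x lower) ⟨
      t - lower + q * (r * lower - lower) ≤⟨ +-monoʳ-≤ _ (*-monoʳ-≤ (<⇒≤ 0<q)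
                                               (-mono-≤ (≤-trans (≤-reflexive r*lower≈rⁿ) rⁿ≤t) ≤-refl)) ⟩
      t - lower + q * (t - lower)         ≈⟨ K*≈ (t - lower) ⟨
      K * (t - lower)                     ∎

    -- `t` lies below `upper` by at least the width of shell `n + 1`, and `q` times that width is
    -- the inner radius of that shell, which exceeds `t`.
    shell-above : ∀ {t} → InShell n t → t ≤ K * (upper - t)
    shell-above {t} (_ , t<rⁿ⁺¹) = begin
      t                           ≤⟨ <⇒≤ t<rⁿ⁺¹ ⟩
      rⁿ⁺¹                        ≈⟨ q*[rx-x]≈x rⁿ⁺¹ ⟨
      q * (r * rⁿ⁺¹ - rⁿ⁺¹)       ≤⟨ *-monoʳ-≤ (<⇒≤ 0<q)
                                       (-mono-≤ (≤-reflexive (≈.sym (^ᶻ-suc (ℤ.suc n)))) (<⇒≤ t<rⁿ⁺¹)) ⟩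
      q * (upper - t)             ≤⟨ x≤y+x _ (x≤y⇒0≤y-x (≤-trans (<⇒≤ t<rⁿ⁺¹) (^ᶻ-step (ℤ.suc n)))) ⟩
      upper - t + q * (upper - t) ≈⟨ K*≈ (upper - t) ⟨
      K * (upper - t)             ∎
      where rⁿ⁺¹ = r ^ᶻ ℤ.suc n

    -- On the shell both boundary terms are at least `d s p`, so the smaller of `d c p` and `d s p`
    -- is at most all three terms. The disjunct tells whether the copy or a new server takes the
    -- request.
    potential-serve : ∀ {p} c → InShell n (d s p) → d c p ≤ potential p c ⊎ d s p ≤ potential p c
    potential-serve {p} c p∈n with total (d c p) (d s p)
    ... | inj₁ c≤s = inj₁ (≤-trans
      (⊓-glb ≤-refl (⊓-glb (≤-trans c≤s (shell-below p∈n)) (≤-trans c≤s (shell-above p∈n)))) (y≤x⊔y 0# _))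
    ... | inj₂ s≤c = inj₂ (≤-trans
      (⊓-glb s≤c (⊓-glb (shell-below p∈n) (shell-above p∈n))) (y≤x⊔y 0# _))

-- Offline bound: a schedule replayed inside one annulus.

module Offline {ℓ a e} (ℝ : RealNumbers ℓ)
               (M : MetricSpace ℝ a e) (s : MetricSpace.Point M)
               (r : RealNumbers.Carrier ℝ) (1<r : RealNumbers._<_ ℝ (RealNumbers.1# ℝ) r) (n : ℤ) where
  open RealNumbers ℝ
  open Shells ℝ M s r 1<r
  open MetricSpace M using (Point; d; nonNegative)
  open InfiniteServer ℝ M s
  open Potential n
  open Pairing using (pair; pair-injective)
  open ServerProperties ℝ M s
  private
    module Mₙ = Server n
    module Serverₙ = ServerProperties ℝ (annulus ℝ M s r n) (source ℝ M s r n)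

  costNear : Configuration → (σ : List Point) → Schedule σ → Carrier
  costNear C σ is = costInto (ℤ.pred n) C σ is + costInto n C σ is + costInto (ℤ.suc n) C σ is

  charge : ℤ → Configuration → Point → ℕ → Carrier
  charge k C p i = chargeIf (inShell? k (d s p)) (d (C i) p)

  charge-nonneg : ∀ k C p i → 0# ≤ charge k C p i
  charge-nonneg k C p i = chargeIf-nonneg (inShell? k (d s p)) nonNegative

  -- The decrease of `K * costNear` at one request, which is what that request may spend.
  gain : Configuration → Point → ℕ → Carrier
  gain C p i = K * (charge (ℤ.pred n) C p i + charge n C p i + charge (ℤ.suc n) C p i)

  costNear-step : ∀ C p σ i is →
    K * costNear C (p ∷ σ) (i ∷ is) ≈ gain C p i + K * costNear (move i p C) σ is
  costNear-step C p σ i is =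
    solve 7 (λ k a b c x y z → k :* (a :+ x :+ (b :+ y) :+ (c :+ z)) := k :* (a :+ b :+ c) :+ k :* (x :+ y :+ z))
      ≈.refl K _ _ _ _ _ _

  shell-or-above : ∀ {t} k → r ^ᶻ k ≤ t → InShell k t ⊎ r ^ᶻ ℤ.suc k ≤ t
  shell-or-above {t} k rᵏ≤t with t <? r ^ᶻ ℤ.suc k
  ... | yes t<rᵏ⁺¹ = inj₁ (rᵏ≤t , t<rᵏ⁺¹)
  ... | no  t≮rᵏ⁺¹ = inj₂ (≮⇒≥ t≮rᵏ⁺¹)

  -- Comparison of `d s p` with the four radii from `lower` to `upper` either finds a charged shell
  -- containing `p` or places `p` where the potential vanishes.
  near-or-far : ∀ C p i → K * d (C i) p ≤ gain C p i ⊎ d s p ≤ lower ⊎ upper ≤ d s p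
  near-or-far C p i with d s p <? lower
  ... | yes p<lower = inj₂ (inj₁ (<⇒≤ p<lower))
  ... | no  p≮lower with shell-or-above (ℤ.pred n) (≮⇒≥ p≮lower)
  ...   | inj₁ p∈n-1 = inj₁ (*-monoʳ-≤ 0≤K (begin
    d (C i) p                                              ≤⟨ chargeIf-yes (inShell? (ℤ.pred n) (d s p)) p∈n-1 ⟩
    charge (ℤ.pred n) C p i                                ≤⟨ x≤x+y _ (charge-nonneg n C p i) ⟩
    charge (ℤ.pred n) C p i + charge n C p i               ≤⟨ x≤x+y _ (charge-nonneg (ℤ.suc n) C p i) ⟩
    _                                                      ∎))
  ...   | inj₂ rⁿ≤p with shell-or-above n (≡.subst (λ k → r ^ᶻ k ≤ d s p) (ℤ.suc-pred n) rⁿ≤p)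
  ...     | inj₁ p∈n = inj₁ (*-monoʳ-≤ 0≤K (begin
    d (C i) p                                              ≤⟨ chargeIf-yes (inShell? n (d s p)) p∈n ⟩
    charge n C p i                                         ≤⟨ x≤y+x _ (charge-nonneg (ℤ.pred n) C p i) ⟩
    charge (ℤ.pred n) C p i + charge n C p i               ≤⟨ x≤x+y _ (charge-nonneg (ℤ.suc n) C p i) ⟩
    _                                                      ∎))
  ...     | inj₂ rⁿ⁺¹≤p with shell-or-above (ℤ.suc n) rⁿ⁺¹≤p
  ...       | inj₂ upper≤p = inj₂ (inj₂ upper≤p)
  ...       | inj₁ p∈n+1 = inj₁ (*-monoʳ-≤ 0≤K (begin
    d (C i) p                                              ≤⟨ chargeIf-yes (inShell? (ℤ.suc n) (d s p)) p∈n+1 ⟩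
    charge (ℤ.suc n) C p i                                 ≤⟨ x≤y+x _ (+-nonneg (charge-nonneg (ℤ.pred n) C p i)
                                                                                (charge-nonneg n C p i)) ⟩
    _                                                      ∎))

  gain-nonneg : ∀ C p i → 0# ≤ gain C p i
  gain-nonneg C p i = *-nonneg 0≤K
    (+-nonneg (+-nonneg (charge-nonneg (ℤ.pred n) C p i) (charge-nonneg n C p i)) (charge-nonneg (ℤ.suc n) C p i))

  -- A near move is paid for by the Lipschitz bound. A move that ends far away leaves no potential
  -- at its endpoint, however long it is.
  potential-gain : ∀ C p i c → potential p c ≤ gain C p i + potential (C i) c
  potential-gain C p i c with near-or-far C p i
  ... | inj₁ near = begin
    potential p c                             ≤⟨ potential-Lipschitz (C i) p c ⟩
    potential (C i) c + K * d (C i) p         ≤⟨ +-monoʳ-≤ _ near ⟩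
    potential (C i) c + gain C p i            ≈⟨ +-comm _ _ ⟩
    gain C p i + potential (C i) c            ∎
  ... | inj₂ far = ≤-trans (potential-far c far) (+-nonneg (gain-nonneg C p i) (potential-nonneg (C i) c))

  -- Server pair i u of the annulus is the u-th incarnation of server i: the incarnation t i is the
  -- current copy of server i, and later incarnations still wait at the source.
  Fresh : Mₙ.Configuration → (ℕ → ℕ) → Set a
  Fresh C′ t = ∀ i u → t i ℕ.< u → proj₁ (C′ (pair i u)) ≡ s

  potentials : Configuration → Mₙ.Configuration → (ℕ → ℕ) → ℕ → Carrier
  potentials C C′ t i = potential (C i) (proj₁ (C′ (pair i (t i))))

  setTo : ℕ → ℕ → (ℕ → ℕ) → ℕ → ℕ
  setTo i u t j = if does (j ℕ.≟ i) then u else t j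

  setTo-≡ : ∀ t i {u} → setTo i u t i ≡ u
  setTo-≡ t i {u} = ≡.cong (if_then u else t i) (dec-true (i ℕ.≟ i) refl)

  setTo-≢ : ∀ t {i j u} → j ≢ i → setTo i u t j ≡ t j
  setTo-≢ t {i} {j} {u} j≢i = ≡.cong (if_then u else t j) (dec-false (j ℕ.≟ i) j≢i)

  -- Amortized analysis by induction on `σ`: the cost of a request in the annulus plus the new
  -- potential of the scheduled server is at most `gain` plus its old potential, and the other
  -- potentials stay. `I` contains all servers of the schedule, which makes the total potential a
  -- finite sum.
  simulate : ∀ {I} → Unique I → ∀ C C′ t σ (is : Schedule σ) → All (_∈ I) (toList is) → Fresh C′ t →
             ∃ λ is′ → Mₙ.costFrom C′ (restrict n σ) is′ ≤ K * costNear C σ is + ∑ I (potentials C C′ t)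
  simulate {I} unique C C′ t [] [] _ _ = [] ,
    +-nonneg (*-nonneg 0≤K (+-nonneg (+-nonneg ≤-refl ≤-refl) ≤-refl)) (∑-nonneg I (λ i → potential-nonneg _ _))
  simulate {I} unique C C′ t (p ∷ σ) (i ∷ is) (i∈I ∷ is∈I) fresh = step (inShell? n (d s p))
    where
    C₁ = move i p C

    -- Here `x` is the cost of the current request in the annulus, zero if the request is dropped.
    budget : ∀ C₁′ t₁ x →
      (∀ j → j ≢ i → potentials C₁ C₁′ t₁ j ≤ potentials C C′ t j) →
      x + potentials C₁ C₁′ t₁ i ≤ gain C p i + potentials C C′ t i →
      x + (K * costNear C₁ σ is + ∑ I (potentials C₁ C₁′ t₁)) ≤
      K * costNear C (p ∷ σ) (i ∷ is) + ∑ I (potentials C C′ t)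
    budget C₁′ t₁ x others at-i = begin
      x + (K * costNear C₁ σ is + ∑ I (potentials C₁ C₁′ t₁))          ≈⟨ swap x _ _ ⟩
      K * costNear C₁ σ is + (x + ∑ I (potentials C₁ C₁′ t₁))          ≤⟨ +-monoʳ-≤ _ (∑-exchange x (gain C p i) unique i∈I others at-i) ⟩
      K * costNear C₁ σ is + (gain C p i + ∑ I (potentials C C′ t))    ≈⟨ solve 3 (λ a b c → a :+ (b :+ c) := b :+ a :+ c) ≈.refl _ (gain C p i) _ ⟩
      gain C p i + K * costNear C₁ σ is + ∑ I (potentials C C′ t)      ≈⟨ +-congʳ (costNear-step C p σ i is) ⟨
      K * costNear C (p ∷ σ) (i ∷ is) + ∑ I (potentials C C′ t)        ∎
      where
      swap : ∀ a b c → a + (b + c) ≈ b + (a + c)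
      swap = solve 3 (λ a b c → a :+ (b :+ c) := b :+ (a :+ c)) ≈.refl

    Served : Dec (InShell n (d s p)) → Set ℓ
    Served p∈n? = ∃ λ (is′ : Mₙ.Schedule (consIf {n} p∈n? (restrict n σ))) →
      Mₙ.costFrom C′ (consIf {n} p∈n? (restrict n σ)) is′ ≤
      K * costNear C (p ∷ σ) (i ∷ is) + ∑ I (potentials C C′ t)

    -- `u` is `t i` for the current copy and `suc (t i)` for a new server, in which case the old
    -- copy is abandoned.
    serveWith : ∀ (p∈n : InShell n (d s p)) u → t i ℕ.≤ u →
                d (proj₁ (C′ (pair i u))) p ≤ potential p (proj₁ (C′ (pair i (t i)))) → Served (yes p∈n)
    serveWith p∈n u tᵢ≤u cheap with simulate unique C₁ (Mₙ.move (pair i u) (p , inj₂ p∈n) C′) (setTo i u t) σ is is∈I fresh₁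
      where
      fresh₁ : Fresh (Mₙ.move (pair i u) (p , inj₂ p∈n) C′) (setTo i u t)
      fresh₁ j v t₁ⱼ<v with j ℕ.≟ i
      ... | yes refl = ≡.trans
        (≡.cong proj₁ (Serverₙ.move-≢ C′ (λ eq → ℕ.<⇒≢ u<v (≡.sym (proj₂ (pair-injective i v i u eq))))))
        (fresh i v (ℕ.≤-<-trans tᵢ≤u u<v))
        where u<v = ≡.subst (ℕ._< v) (setTo-≡ t i) t₁ⱼ<v
      ... | no j≢i = ≡.trans
        (≡.cong proj₁ (Serverₙ.move-≢ C′ (λ eq → j≢i (proj₁ (pair-injective j v i u eq)))))
        (fresh j v (≡.subst (ℕ._< v) (setTo-≢ t j≢i) t₁ⱼ<v))
    ... | is′ , ≤budget = pair i u ∷ is′ ,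
      ≤-trans (+-monoʳ-≤ _ ≤budget) (budget C₁′ t₁ (d (proj₁ (C′ (pair i u))) p) others at-i)
      where
      C₁′ = Mₙ.move (pair i u) (p , inj₂ p∈n) C′
      t₁ = setTo i u t
      others : ∀ j → j ≢ i → potentials C₁ C₁′ t₁ j ≤ potentials C C′ t j
      others j j≢i = ≤-reflexive (≈.reflexive (≡.cong₂ potential (move-≢ C j≢i)
        (≡.trans
          (≡.cong proj₁ (Serverₙ.move-≢ C′ (λ eq → j≢i (proj₁ (pair-injective j (t₁ j) i u eq)))))
          (≡.cong (λ v → proj₁ (C′ (pair j v))) (setTo-≢ t j≢i)))))
      C₁′ᵢ≡p : proj₁ (C₁′ (pair i (t₁ i))) ≡ p
      C₁′ᵢ≡p = ≡.trans (≡.cong (λ v → proj₁ (C₁′ (pair i v))) (setTo-≡ t i)) (≡.cong proj₁ (Serverₙ.move-≡ C′ (pair i u)))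
      at-i : d (proj₁ (C′ (pair i u))) p + potentials C₁ C₁′ t₁ i ≤ gain C p i + potentials C C′ t i
      at-i = begin
        d (proj₁ (C′ (pair i u))) p + potentials C₁ C₁′ t₁ i ≡⟨ ≡.cong₂ (λ x c → d (proj₁ (C′ (pair i u))) p + potential x c) (move-≡ C i) C₁′ᵢ≡p ⟩
        -- The current copy now stands at `p`, so its potential vanishes, and the potential of `p`
        -- relative to the old copy covers the cost.
        d (proj₁ (C′ (pair i u))) p + potential p p          ≤⟨ +-mono-≤ cheap (potential-self p) ⟩
        potential p (proj₁ (C′ (pair i (t i)))) + 0#         ≈⟨ +-identityʳ _ ⟩
        potential p (proj₁ (C′ (pair i (t i))))              ≤⟨ potential-gain C p i _ ⟩
        gain C p i + potentials C C′ t i                     ∎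

    step : ∀ p∈n? → Served p∈n?
    -- Nothing is served in the annulus, yet server `i` of the schedule moves away from or towards
    -- its copy; `gain` covers a rise of the potential.
    step (no _) with simulate unique C₁ C′ t σ is is∈I fresh
    ... | is′ , ≤budget = is′ , ≤-trans (≤-trans ≤budget (x≤y+x _ ≤-refl)) (budget C′ t 0# others at-i)
      where
      others : ∀ j → j ≢ i → potentials C₁ C′ t j ≤ potentials C C′ t j
      others j j≢i = ≤-reflexive (≈.reflexive
        (≡.cong (λ x → potential x (proj₁ (C′ (pair j (t j))))) (move-≢ C j≢i)))
      at-i : 0# + potentials C₁ C′ t i ≤ gain C p i + potentials C C′ t i
      at-i = begin
        0# + potentials C₁ C′ t i               ≈⟨ +-identityˡ _ ⟩
        potentials C₁ C′ t i                    ≡⟨ ≡.cong (λ x → potential x (proj₁ (C′ (pair i (t i))))) (move-≡ C i) ⟩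
        potential p (proj₁ (C′ (pair i (t i)))) ≤⟨ potential-gain C p i _ ⟩
        gain C p i + potentials C C′ t i        ∎

    step (yes p∈n) with potential-serve (proj₁ (C′ (pair i (t i)))) p∈n
    ... | inj₁ copy = serveWith p∈n (t i) ℕ.≤-refl copy
    -- The next incarnation is still at the source, so its distance to `p` is `d s p`.
    ... | inj₂ new  = serveWith p∈n (suc (t i)) (ℕ.n≤1+n (t i))
      (≡.subst (λ x → d x p ≤ potential p (proj₁ (C′ (pair i (t i))))) (≡.sym (fresh i (suc (t i)) (ℕ.n<1+n (t i)))) new)

  -- Servers and copies all start at `s`, so the initial potentials vanish. Deduplication yields a
  -- list with each scheduled server exactly once.
  OPT-bound : ∀ σ is → Mₙ.OPT (restrict n σ) ≤ K * costNear initial σ is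
  OPT-bound σ is with simulate (deduplicate-! ℕ._≟_ (toList is)) initial Mₙ.initial (λ _ → 0) σ is
                        (All.tabulate (∈-deduplicate⁺ ℕ._≟_)) (λ _ _ _ → refl)
  ... | is′ , ≤budget = begin
    Mₙ.OPT (restrict n σ)                                 ≤⟨ proj₁ (Mₙ.OPT-infimum (restrict n σ)) _ (is′ , ≈.refl) ⟩
    Mₙ.cost (restrict n σ) is′                            ≤⟨ ≤budget ⟩
    K * costNear initial σ is + ∑ I (λ _ → potential s s) ≤⟨ +-monoʳ-≤ _ (∑-nonpos I (λ _ → potential-self s)) ⟩
    K * costNear initial σ is + 0#                        ≈⟨ +-identityʳ _ ⟩
    K * costNear initial σ is                             ∎
    where I = deduplicate ℕ._≟_ (toList is)

-- Online algorithm: the given algorithms on disjoint pools.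

module Online {ℓ a e} (ℝ : RealNumbers ℓ)
              (M : MetricSpace ℝ a e) (s : MetricSpace.Point M)
              (r : RealNumbers.Carrier ℝ) (1<r : RealNumbers._<_ ℝ (RealNumbers.1# ℝ) r)
              (A : ∀ n → InfiniteServer.OnlineAlgorithm ℝ (annulus ℝ M s r n) (source ℝ M s r n)) where
  open RealNumbers ℝ
  open Shells ℝ M s r 1<r
  open MetricSpace M using (Point; d; nonNegative; module EqC; ≈⇒0; 0⇒≈)
  open InfiniteServer ℝ M s
  open ServerProperties ℝ M s
  open Pairing
  private
    infix 4 _≈ₚ_
    _≈ₚ_ = MetricSpace._≈_ M
    module A n = Server.OnlineAlgorithm n (A n)
    module Serverₙ n = ServerProperties ℝ (annulus ℝ M s r n) (source ℝ M s r n)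

  d-congʳ : ∀ {p p′} → p ≈ₚ p′ → d s p ≈ d s p′
  d-congʳ = MetricSpace.cong M EqC.refl

  restrict-cong : ∀ n {σ σ′} → Pointwise _≈ₚ_ σ σ′ →
                  Pointwise (MetricSpace._≈_ (annulus ℝ M s r n)) (restrict n σ) (restrict n σ′)
  restrict-cong n []                           = []
  restrict-cong n {p ∷ σ} {p′ ∷ σ′} (p≈p′ ∷ σ≈σ′) with inShell? n (d s p) | inShell? n (d s p′)
  ... | yes _   | yes _    = p≈p′ ∷ restrict-cong n σ≈σ′
  ... | no  _   | no  _    = restrict-cong n σ≈σ′
  ... | yes p∈n | no  p′∉n = contradiction (InShell-resp-≈ n (d-congʳ p≈p′) p∈n) p′∉n
  ... | no  p∉n | yes p′∈n = contradiction (InShell-resp-≈ n (≈.sym (d-congʳ p≈p′)) p′∈n) p∉n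

  Location : Point → Set ℓ
  Location p = d s p ≈ 0# ⊎ ∃ λ n → InShell n (d s p)

  locate : ∀ p → Location p
  locate p with d s p ≟ 0#
  ... | yes d≈0 = inj₁ d≈0
  ... | no  d≉0 with nonNegative {s} {p}
  ...   | inj₁ 0<d = inj₂ (shell-exists 0<d)
  ...   | inj₂ 0≈d = contradiction (≈.sym 0≈d) d≉0

  ≈0⇒∉shell : ∀ {t} n → t ≈ 0# → ¬ InShell n t
  ≈0⇒∉shell n t≈0 (rⁿ≤t , _) = <⇒≱ (^ᶻ-pos n) (≤-trans rⁿ≤t (≤-reflexive t≈0))

  -- With the location as an argument, congruence can be shown for any two locations. Requests at
  -- distance zero go to a dedicated server, which thus never leaves the source up to equality of
  -- points.
  serverFor : List Point → (p : Point) → Location p → ℕ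
  serverFor past p (inj₁ _)         = sourceServer
  serverFor past p (inj₂ (n , p∈n)) = poolServer n (A.respond n (restrict n past) (p , inj₂ p∈n))

  -- Equal points have locations of the same kind, and by `shell-unique` these name the same
  -- annulus.
  serverFor-cong : ∀ {past past′ p p′} → Pointwise _≈ₚ_ past past′ → p ≈ₚ p′ →
                   ∀ l l′ → serverFor past p l ≡ serverFor past′ p′ l′
  serverFor-cong _ _ (inj₁ _) (inj₁ _) = refl
  serverFor-cong _ p≈p′ (inj₁ d≈0) (inj₂ (n , p′∈n)) =
    contradiction (InShell-resp-≈ n (≈.sym (d-congʳ p≈p′)) p′∈n) (≈0⇒∉shell n d≈0)
  serverFor-cong _ p≈p′ (inj₂ (n , p∈n)) (inj₁ d′≈0) =
    contradiction (InShell-resp-≈ n (d-congʳ p≈p′) p∈n) (≈0⇒∉shell n d′≈0)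
  serverFor-cong past≈ p≈p′ (inj₂ (m , p∈m)) (inj₂ (n , p′∈n))
    with refl ← shell-unique m n (InShell-resp-≈ m (d-congʳ p≈p′) p∈m) p′∈n =
    ≡.cong (poolServer m) (A.respects-≈ m (restrict-cong m past≈) p≈p′)

  combined : OnlineAlgorithm
  combined = record
    { respond    = λ past p → serverFor past p (locate p)
    ; respects-≈ = λ {_} {_} {p} {p′} past≈ p≈p′ → serverFor-cong past≈ p≈p′ (locate p) (locate p′)
    }
  open OnlineAlgorithm combined using (scheduleAfter; ALG)

  Configurations : Set _
  Configurations = ∀ n → Server.Configuration n

  costAfter : ∀ n → Server.Configuration n → List (AnnulusPoint n) → List (AnnulusPoint n) → Carrier
  costAfter n C past σ = Server.costFrom n C σ (A.scheduleAfter n past σ)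

  -- Equality in the annulus ignores membership proofs, so `respects-≈` identifies the two
  -- responses.
  respond-irrelevant : ∀ n past {p} (p∈n p∈n′ : InShell n (d s p)) →
                       A.respond n past (p , inj₂ p∈n) ≡ A.respond n past (p , inj₂ p∈n′)
  respond-irrelevant n past _ _ =
    A.respects-≈ n (Pointwise.refl (λ {x} → EqC.refl {proj₁ x})) EqC.refl

  next : ∀ n → Server.Configuration n → List (AnnulusPoint n) → ∀ {p} → Dec (InShell n (d s p)) → Server.Configuration n
  next n C past {p} (yes p∈n) = Server.move n (A.respond n past (p , inj₂ p∈n)) (p , inj₂ p∈n) C
  next n C past     (no _)    = C

  next-costAfter : ∀ n C past {p} σ (p∈n? : Dec (InShell n (d s p))) →
    costAfter n (next n C past p∈n?) (consIf {n} p∈n? past) σ ≤ costAfter n C past (consIf {n} p∈n? σ)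
  next-costAfter n C past σ (yes _) = x≤y+x _ nonNegative
  next-costAfter n C past σ (no _)  = ≤-refl

  serve-costAfter : ∀ n C past {p} σ (p∈n? : Dec (InShell n (d s p))) (p∈n : InShell n (d s p)) →
    d (proj₁ (C (A.respond n past (p , inj₂ p∈n)))) p + costAfter n (next n C past p∈n?) (consIf {n} p∈n? past) σ ≤
    costAfter n C past (consIf {n} p∈n? σ)
  serve-costAfter n C past {p} σ (yes p∈n′) p∈n = +-monoˡ-≤ _ (≤-reflexive (≈.reflexive
    (≡.cong (λ i → d (proj₁ (C i)) p) (respond-irrelevant n past p∈n p∈n′))))
  serve-costAfter n C past σ (no p∉n) p∈n = contradiction p∈n p∉n

  Simulates : Configuration → Configurations → Set a
  Simulates C Cₙ = ∀ n j → proj₁ (Cₙ n j) ≡ C (poolServer n j)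

  -- A request affects at most the pool of its own annulus; injectivity of the numbering keeps all
  -- other pools fixed.
  simulates-next : ∀ C Cₙ past p → Simulates C Cₙ → ∀ (l : Location p) n (p∈n? : Dec (InShell n (d s p))) j →
    proj₁ (next n (Cₙ n) (restrict n past) p∈n? j) ≡ move (serverFor past p l) p C (poolServer n j)
  simulates-next C Cₙ past p _ (inj₁ d≈0) n (yes p∈n) j = contradiction p∈n (≈0⇒∉shell n d≈0)
  simulates-next C Cₙ past p sim (inj₁ _) n (no _) j = ≡.trans (sim n j)
    (≡.sym (move-≢ C (source≢pool n j ∘ ≡.sym)))
  simulates-next C Cₙ past p sim (inj₂ (k , p∈k)) n (no p∉n) j = ≡.trans (sim n j)
    (≡.sym (move-≢ C (λ eq → p∉n (≡.subst (λ m → InShell m (d s p))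
      (≡.sym (code-injective n k (proj₁ (pair-injective (code n) j (code k) _ eq)))) p∈k))))
  simulates-next C Cₙ past p sim (inj₂ (k , p∈k)) n (yes p∈n) j
    with refl ← shell-unique k n p∈k p∈n
    rewrite respond-irrelevant k (restrict k past) p∈k p∈n
    with j ℕ.≟ A.respond k (restrict k past) (p , inj₂ p∈n)
  ... | yes refl = ≡.trans (≡.cong proj₁ (Serverₙ.move-≡ k (Cₙ k) j)) (≡.sym (move-≡ C (poolServer k j)))
  ... | no j≢i = ≡.trans (≡.cong proj₁ (Serverₙ.move-≢ k (Cₙ k) j≢i))
    (≡.trans (sim k j) (≡.sym (move-≢ C (λ eq → j≢i (proj₂ (pair-injective (code k) j (code k) _ eq))))))

  -- A request in annulus `k` costs what the algorithm for `k` pays, and no other algorithm's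
  -- remaining cost rises; requests at the source are free. The position of the source server is
  -- known only up to `≈ₚ`, since it moves to requested points equal to `s`.
  costFrom-combined : ∀ {ns} → Unique ns → ∀ C Cₙ past σ → C sourceServer ≈ₚ s → Simulates C Cₙ →
    All (λ p → ∀ n → InShell n (d s p) → n ∈ ns) σ →
    costFrom C σ (scheduleAfter past σ) ≤ ∑ ns (λ n → costAfter n (Cₙ n) (restrict n past) (restrict n σ))
  costFrom-combined {ns} unique C Cₙ past [] _ _ _ = ∑-nonneg ns (λ _ → ≤-refl)
  costFrom-combined {ns} unique C Cₙ past (p ∷ σ) atSource sim (p∈ns ∷ σ∈ns) = go (locate p)
    where
    Cₙ′ : Configurations
    Cₙ′ n = next n (Cₙ n) (restrict n past) (inShell? n (d s p))

    before after : ℤ → Carrier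
    before n = costAfter n (Cₙ n) (restrict n past) (restrict n (p ∷ σ))
    after n  = costAfter n (Cₙ′ n) (restrict n (p ∷ past)) (restrict n σ)

    after≤before : ∀ n → after n ≤ before n
    after≤before n = next-costAfter n (Cₙ n) (restrict n past) (restrict n σ) (inShell? n (d s p))

    rest : ∀ l → move (serverFor past p l) p C sourceServer ≈ₚ s →
           costFrom (move (serverFor past p l) p C) σ (scheduleAfter (p ∷ past) σ) ≤ ∑ ns after
    rest l atSource′ = costFrom-combined unique (move (serverFor past p l) p C) Cₙ′ (p ∷ past) σ atSource′
      (λ n → simulates-next C Cₙ past p sim l n (inShell? n (d s p))) σ∈ns

    go : ∀ l → d (C (serverFor past p l)) p + costFrom (move (serverFor past p l) p C) σ (scheduleAfter (p ∷ past) σ) ≤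
               ∑ ns before
    go (inj₁ d≈0) = begin
      d (C sourceServer) p + costFrom _ σ (scheduleAfter (p ∷ past) σ) ≤⟨ +-mono-≤ (≤-reflexive (≈⇒0 (EqC.trans atSource s≈p)))
        (rest (inj₁ d≈0) (EqC.trans (EqC.reflexive (move-≡ C sourceServer)) (EqC.sym s≈p))) ⟩
      0# + ∑ ns after ≈⟨ +-identityˡ _ ⟩
      ∑ ns after      ≤⟨ ∑-mono ns (λ {n} _ → after≤before n) ⟩
      ∑ ns before     ∎
      where
      s≈p : s ≈ₚ p
      s≈p = 0⇒≈ d≈0
    go l@(inj₂ (k , p∈k)) = begin
      d (C i) p + costFrom _ σ (scheduleAfter (p ∷ past) σ) ≤⟨ +-monoʳ-≤ _
        (rest l (EqC.trans (EqC.reflexive (move-≢ C (source≢pool k _))) atSource)) ⟩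
      d (C i) p + ∑ ns after  ≤⟨ ∑-exchange (d (C i) p) 0# unique (p∈ns k p∈k) (λ n _ → after≤before n) at-k ⟩
      0# + ∑ ns before        ≈⟨ +-identityˡ _ ⟩
      ∑ ns before             ∎
      where
      i = serverFor past p l
      at-k : d (C i) p + after k ≤ 0# + before k
      at-k = begin
        d (C i) p + after k ≡⟨ ≡.cong (λ c → d c p + after k) (sim k _) ⟨
        _                   ≤⟨ serve-costAfter k (Cₙ k) (restrict k past) (restrict k σ) (inShell? k (d s p)) p∈k ⟩
        before k            ≈⟨ +-identityˡ _ ⟨
        0# + before k       ∎

  shells : List Point → List ℤ
  shells []      = []
  shells (p ∷ σ) with locate p
  ... | inj₁ _       = shells σ
  ... | inj₂ (n , _) = n ∷ shells σ

  shells-complete : ∀ σ → All (λ p → ∀ n → InShell n (d s p) → n ∈ shells σ) σ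
  shells-complete []      = []
  shells-complete (p ∷ σ) with locate p
  ... | inj₁ d≈0       = (λ n p∈n → contradiction p∈n (≈0⇒∉shell n d≈0)) ∷ shells-complete σ
  ... | inj₂ (k , p∈k) = (λ n p∈n → here (shell-unique n k p∈n p∈k)) ∷
    All.map (λ complete n p∈n → there (complete n p∈n)) (shells-complete σ)

  -- Without repetitions, so that each annulus enters the sums once.
  annuli : List Point → List ℤ
  annuli σ = deduplicate ℤ._≟_ (shells σ)

  annuli-unique : ∀ σ → Unique (annuli σ)
  annuli-unique σ = deduplicate-! ℤ._≟_ (shells σ)

  ALG-combined : ∀ σ → ALG σ ≤ ∑ (annuli σ) (λ n → A.ALG n (restrict n σ))
  ALG-combined σ = costFrom-combined (annuli-unique σ) initial (λ n → Server.initial n) [] σ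
    EqC.refl (λ _ _ → refl)
    (All.map (λ complete n p∈n → ∈-deduplicate⁺ ℤ._≟_ (complete n p∈n)) (shells-complete σ))

-- The competitive ratio of the combined algorithm.

theorem10 : ∀ {ℓ a e} (ℝ : RealNumbers ℓ) → let open RealNumbers ℝ in
    (M : MetricSpace ℝ a e) (s : MetricSpace.Point M) (r ρ : Carrier) → 1# < r →
    (∀ (n : ℤ) → AdmitsStrictlyCompetitive ℝ (annulus ℝ M s r n) (source ℝ M s r n) ρ) →
    AdmitsStrictlyCompetitive ℝ M s (((4 · r) - 1#) * ((r - 1#) ⁻¹) * ρ)
theorem10 ℝ M s r ρ 1<r competitive = combined , ALG≤
  where
  open RealNumbers ℝ
  open Shells ℝ M s r 1<r
  open InfiniteServer ℝ M s
  open Online ℝ M s r 1<r (λ n → proj₁ (competitive n))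
  module Serverₙ n = ServerProperties ℝ (annulus ℝ M s r n) (source ℝ M s r n)

  c : Carrier
  c = (4 · r - 1#) * (r - 1#) ⁻¹

  0<c : 0# < c
  0<c = begin-strict
    0#             <⟨ 0<1 ⟩
    1#             ≤⟨ x≤y+x 1# (+-nonneg (+-nonneg 0≤K 0≤K) 0≤K) ⟩
    K + K + K + 1# ≈⟨ competitiveRatio≈ ⟨
    c              ∎

  OPTₙ ALGₙ : List (MetricSpace.Point M) → ℤ → Carrier
  OPTₙ σ n = Server.OPT n (restrict n σ)
  ALGₙ σ n = InfiniteServer.OnlineAlgorithm.ALG (proj₁ (competitive n)) (restrict n σ)

  -- Summing `OPT-bound` gives three sums of booked costs, shifted by -1, 0 and 1, each at most the
  -- cost of the schedule. As this holds for every schedule, it passes to the infimum.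
  ∑OPTₙ≤ : ∀ {ns} → Unique ns → ∀ σ → ∑ ns (OPTₙ σ) ≤ c * OPT σ
  ∑OPTₙ≤ {ns} unique σ = infimum-scale 0<c (OPT-infimum σ) λ { x (is , x≈) → begin
    ∑ ns (OPTₙ σ)                                      ≤⟨ ∑-mono ns (λ {n} _ → Offline.OPT-bound ℝ M s r 1<r n σ is) ⟩
    ∑ ns (λ n → K * (D is (ℤ.pred n) + D is n + D is (ℤ.suc n)))  ≈⟨ ∑-*ˡ ns K _ ⟩
    K * ∑ ns (λ n → D is (ℤ.pred n) + D is n + D is (ℤ.suc n))    ≈⟨ *-congˡ (≈.trans (∑-+ ns _ _) (+-congʳ (∑-+ ns _ _))) ⟩
    K * (∑ ns (D is ∘ ℤ.pred) + ∑ ns (D is) + ∑ ns (D is ∘ ℤ.suc))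
      ≤⟨ *-monoʳ-≤ 0≤K (+-mono-≤ (+-mono-≤
           (∑-costInto ℤ.pred unique pred-injective initial σ is)
           (∑-costInto id unique id initial σ is))
           (∑-costInto ℤ.suc unique suc-injective initial σ is)) ⟩
    -- The factor `3K` is relaxed to `3K + 1`, which is `c`.
    K * (cost σ is + cost σ is + cost σ is)            ≤⟨ x≤x+y _ (costFrom-nonneg initial σ is) ⟩
    K * (cost σ is + cost σ is + cost σ is) + cost σ is
      ≈⟨ solve 2 (λ K x → K :* (x :+ x :+ x) :+ x := (K :+ K :+ K :+ con 1) :* x) ≈.refl K (cost σ is) ⟩
    (K + K + K + 1#) * cost σ is                       ≈⟨ *-cong competitiveRatio≈ x≈ ⟨
    c * x                                              ∎ }
    where
    D : Schedule σ → ℤ → Carrier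
    D is n = costInto n initial σ is
    pred-injective : ∀ {m n} → ℤ.pred m ≡ ℤ.pred n → m ≡ n
    pred-injective {m} {n} eq = ≡.trans (≡.sym (ℤ.suc-pred m)) (≡.trans (≡.cong ℤ.suc eq) (ℤ.suc-pred n))
    suc-injective : ∀ {m n} → ℤ.suc m ≡ ℤ.suc n → m ≡ n
    suc-injective {m} {n} eq = ≡.trans (≡.sym (ℤ.pred-suc m)) (≡.trans (≡.cong ℤ.pred eq) (ℤ.pred-suc n))

  ALG≤ : StrictlyCompetitive (c * ρ) combined
  ALG≤ σ with 0# ≤? ρ
  -- For nonnegative `ρ`, multiplication by `ρ` preserves the bound on the summed optima.
  ... | yes 0≤ρ = begin
    OnlineAlgorithm.ALG combined σ         ≤⟨ ALG-combined σ ⟩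
    ∑ (annuli σ) (ALGₙ σ)                  ≤⟨ ∑-mono (annuli σ) (λ {n} _ → proj₂ (competitive n) (restrict n σ)) ⟩
    ∑ (annuli σ) (λ n → ρ * OPTₙ σ n)      ≈⟨ ∑-*ˡ (annuli σ) ρ (OPTₙ σ) ⟩
    ρ * ∑ (annuli σ) (OPTₙ σ)              ≤⟨ *-monoʳ-≤ 0≤ρ (∑OPTₙ≤ (annuli-unique σ) σ) ⟩
    ρ * (c * OPT σ)                        ≈⟨ solve 3 (λ a b x → a :* (b :* x) := b :* a :* x) ≈.refl ρ c (OPT σ) ⟩
    c * ρ * OPT σ                          ∎
  -- The competitive ratio ρ can only be negative if all costs vanish.
  ... | no 0≰ρ = begin
    OnlineAlgorithm.ALG combined σ ≤⟨ ALG≤0 ⟩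
    0#                             ≤⟨ *-nonpos-nonpos (*-nonpos (<⇒≤ 0<c) ρ≤0) OPT≤0 ⟩
    c * ρ * OPT σ                  ∎
    where
    ρ≤0 : ρ ≤ 0#
    ρ≤0 with total 0# ρ
    ... | inj₁ 0≤ρ = contradiction 0≤ρ 0≰ρ
    ... | inj₂ ρ≤0 = ρ≤0
    ALG≤0 : OnlineAlgorithm.ALG combined σ ≤ 0#
    ALG≤0 = ≤-trans (ALG-combined σ) (∑-nonpos (annuli σ) (λ n →
      ≤-trans (proj₂ (competitive n) (restrict n σ)) (*-nonposˡ ρ≤0 (Serverₙ.OPT-nonneg n (restrict n σ)))))
    -- The cost of the combined algorithm is attainable, hence bounds the optimum from above.
    OPT≤0 : OPT σ ≤ 0#
    OPT≤0 = ≤-trans (proj₁ (OPT-infimum σ) _ (OnlineAlgorithm.scheduleAfter combined [] σ , ≈.refl)) ALG≤0
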